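{- Let $k=k(n)$ and $m=m(n)$ be functions of $n$. (i) Suppose that $\frac{k^2n}{m}=\log n+\omega$, where $\omega=\omega(n)\rightarrow\infty$ as $n\rightarrow\infty$. Then asymptotically almost surely $G(n,m,k)$ contains no isolated vertex. (ii) Suppose that $\frac{k^2n}{m}=\log n-\omega$, where $\omega=\omega(n)\rightarrow\infty$ as $n\rightarrow\infty$. Then asymptotically almost surely $G(n,m,k)$ contains an isolated vertex.
   Context: The uniform random intersection graph $G(n,m,k)$ (for positive integers $k\le m$) is the random graph on a set $V$ of $n$ nodes defined as follows: fix a set $M$ of $m$ colours; to each node $v\in V$ assign a subset $F_v\subseteq M$ of exactly $k$ distinct colours, chosen uniformly at random among all $k$-subsets of $M$, independently for different nodes; distinct nodes $u,v$ are joined by an edge if and only if $F_u\cap F_v\neq\emptyset$. An event holds asymptotically almost surely if its probability tends to $1$ as $n\rightarrow\infty$. Here $\log$ denotes the natural logarithm. -}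

module Defs where

open import Data.Fin.Base using (Fin)
import Data.Fin.Properties as Fin
open import Data.Fin.Subset using (Subset; inside; outside; _∩_; ∣_∣; Nonempty; ⊥)
open import Data.Fin.Subset.Properties using (nonempty?; ∩-comm; ∣⊥∣≡0)
open import Data.Integer.Base as ℤ using (+_)
import Data.Integer.Properties as ℤ
open import Data.List.Base using (List; []; _∷_; _++_; map; filter; length; cartesianProductWith)
open import Data.List.Membership.Propositional using (_∈_)
open import Data.List.Membership.Propositional.Properties using (∈-map⁺; ∈-++⁺ˡ; ∈-++⁺ʳ; ∈-filter⁺; ∈-cartesianProductWith⁺; ∈-length)
open import Data.List.Relation.Unary.Any using (here)
open import Data.Nat.Base as ℕ using (ℕ; zero; suc; pred; NonZero)
import Data.Nat.Properties as ℕ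
open import Data.Nat.Solver using (module +-*-Solver)
open import Data.Product.Base using (∃; _×_; _,_; proj₂)
open import Data.Rational.Base as ℚ using (ℚ; 0ℚ; 1ℚ; _/_; _+_; _-_; -_; _*_; _≤_; _<_; toℚᵘ)
import Data.Rational.Properties as ℚ
open import Data.Rational.Solver using () renaming (module +-*-Solver to ℚ-Solver)
open import Data.Rational.Unnormalised.Base as ℚᵘ using (mkℚᵘ; *≤*; *≡*)
import Data.Rational.Unnormalised.Properties as ℚᵘ
open import Data.Sum.Base using (inj₁; inj₂)
open import Data.Vec.Base using (Vec; []; _∷_; lookup)
open import Level using (0ℓ)
open import Relation.Binary.Core using (Rel)
open import Relation.Binary.Definitions using () renaming (Decidable to Decidable₂)
open import Relation.Binary.PropositionalEquality using (_≡_; _≢_; refl; sym; trans; cong; cong₂; subst; subst₂; module ≡-Reasoning)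
open import Relation.Nullary using (¬_; ¬?; _×-dec_)
open import Relation.Unary using (Pred; Decidable)

------------------------------------------------------------------------
-- Bishop reals: regular sequences of rationals, index i standing for
-- precision 1/(i+1).

1/1+_ : ℕ → ℚ
1/1+ i = + 1 / suc i

infix 8 1/1+_

record ℝ : Set where
  constructor mkℝ
  field
    approx  : ℕ → ℚ
    regular : ∀ i j → ℚ.∣ approx i - approx j ∣ ≤ 1/1+ i + 1/1+ j

open ℝ public

infix 4 _≃_ _≤ᴿ_

_≃_ : Rel ℝ 0ℓ
x ≃ y = ∀ i → ℚ.∣ approx x i - approx y i ∣ ≤ 1/1+ i + 1/1+ i

_≤ᴿ_ : Rel ℝ 0ℓ
x ≤ᴿ y = ∀ i → approx x i ≤ approx y i + (1/1+ i + 1/1+ i)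

module _ where
  open ℚᵘ.≤-Reasoning

  1/1+-anti : ∀ {i j} → i ℕ.≤ j → 1/1+ j ≤ 1/1+ i
  1/1+-anti {i} {j} i≤j = ℚ.toℚᵘ-cancel-≤ (begin
    toℚᵘ (1/1+ j)   ≃⟨ ℚ.toℚᵘ-fromℚᵘ (mkℚᵘ (+ 1) j) ⟩
    mkℚᵘ (+ 1) j    ≤⟨ *≤* (ℤ.*-monoˡ-≤-nonNeg (+ 1) (ℤ.+≤+ (ℕ.s≤s i≤j))) ⟩
    mkℚᵘ (+ 1) i    ≃⟨ ℚᵘ.≃-sym (ℚ.toℚᵘ-fromℚᵘ (mkℚᵘ (+ 1) i)) ⟩
    toℚᵘ (1/1+ i)   ∎)

0≤1/1+ : ∀ i → 0ℚ ≤ 1/1+ i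
0≤1/1+ i = ℚ.nonNegative⁻¹ (1/1+ i) {{ℚ.pos⇒nonNeg (1/1+ i) {{ℚ.normalize-pos 1 (suc i)}}}}

0≤1/1++1/1+ : ∀ i j → 0ℚ ≤ 1/1+ i + 1/1+ j
0≤1/1++1/1+ i j = ℚ.+-mono-≤ (0≤1/1+ i) (0≤1/1+ j)

fromℚ : ℚ → ℝ
fromℚ q .approx _ = q
fromℚ q .regular i j = subst (_≤ 1/1+ i + 1/1+ j) (cong ℚ.∣_∣ (sym (ℚ.+-inverseʳ q))) (0≤1/1++1/1+ i j)

scale-1/1+ : ∀ c a b → suc c ℕ.* suc a ≡ suc b → (+ suc c / 1) * 1/1+ b ≡ 1/1+ a
scale-1/1+ c a b eq = ℚ.toℚᵘ-injective (begin-equality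
  toℚᵘ ((+ suc c / 1) * 1/1+ b)              ≃⟨ ℚ.toℚᵘ-homo-* (+ suc c / 1) (1/1+ b) ⟩
  toℚᵘ (+ suc c / 1) ℚᵘ.* toℚᵘ (1/1+ b)      ≃⟨ ℚᵘ.*-cong (ℚ.toℚᵘ-fromℚᵘ (mkℚᵘ (+ suc c) 0)) (ℚ.toℚᵘ-fromℚᵘ (mkℚᵘ (+ 1) b)) ⟩
  mkℚᵘ (+ suc c) 0 ℚᵘ.* mkℚᵘ (+ 1) b         ≃⟨ *≡* (cong +_ numeric) ⟩
  mkℚᵘ (+ 1) a                               ≃⟨ ℚᵘ.≃-sym (ℚ.toℚᵘ-fromℚᵘ (mkℚᵘ (+ 1) a)) ⟩
  toℚᵘ (1/1+ a)                              ∎)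
  where
  open ℚᵘ.≤-Reasoning
  numeric : suc c ℕ.* 1 ℕ.* suc a ≡ 1 ℕ.* suc (b ℕ.+ 0)
  numeric = trans (cong (ℕ._* suc a) (ℕ.*-identityʳ (suc c)))
    (trans eq (sym (trans (ℕ.*-identityˡ (suc (b ℕ.+ 0))) (cong suc (ℕ.+-identityʳ b)))))

-- index of the precision 1/(2(i+1))
double : ℕ → ℕ
double i = i ℕ.+ suc i

half-1/1+ : ∀ i → 1/1+ double i + 1/1+ double i ≡ 1/1+ i
half-1/1+ i = trans two (scale-1/1+ 1 i (double i) (solve 1 (λ x → con 2 :* (con 1 :+ x) := con 1 :+ (x :+ (con 1 :+ x))) refl i))
  where
  open +-*-Solver
  x = 1/1+ double i
  two : x + x ≡ (+ 2 / 1) * x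
  two = sym (trans (ℚ.*-distribʳ-+ x 1ℚ 1ℚ) (cong₂ _+_ (ℚ.*-identityˡ x) (ℚ.*-identityˡ x)))

infixl 6 _+ᴿ_ _-ᴿ_
infix 8 -ᴿ_

_+ᴿ_ : ℝ → ℝ → ℝ
(x +ᴿ y) .approx i = approx x (double i) + approx y (double i)
(x +ᴿ y) .regular i j = begin
  ℚ.∣ (a + b) - (c + d) ∣                 ≡⟨ cong ℚ.∣_∣ (solve 4 (λ a b c d → (a :+ b) :- (c :+ d) := (a :- c) :+ (b :- d)) refl a b c d) ⟩
  ℚ.∣ (a - c) + (b - d) ∣                 ≤⟨ ℚ.∣p+q∣≤∣p∣+∣q∣ (a - c) (b - d) ⟩
  ℚ.∣ a - c ∣ + ℚ.∣ b - d ∣               ≤⟨ ℚ.+-mono-≤ (regular x (double i) (double j)) (regular y (double i) (double j)) ⟩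
  (u + v) + (u + v)                       ≡⟨ solve 2 (λ u v → (u :+ v) :+ (u :+ v) := (u :+ u) :+ (v :+ v)) refl u v ⟩
  (u + u) + (v + v)                       ≡⟨ cong₂ _+_ (half-1/1+ i) (half-1/1+ j) ⟩
  1/1+ i + 1/1+ j                         ∎
  where
  open ℚ.≤-Reasoning
  open ℚ-Solver
  a = approx x (double i)
  b = approx y (double i)
  c = approx x (double j)
  d = approx y (double j)
  u = 1/1+ double i
  v = 1/1+ double j

-ᴿ_ : ℝ → ℝ
(-ᴿ x) .approx i = - approx x i
(-ᴿ x) .regular i j = subst (_≤ 1/1+ i + 1/1+ j)
  (trans (sym (ℚ.∣-p∣≡∣p∣ (approx x i - approx x j))) (cong ℚ.∣_∣ (ℚ.neg-distrib-+ (approx x i) (- approx x j))))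
  (regular x i j)

_-ᴿ_ : ℝ → ℝ → ℝ
x -ᴿ y = x +ᴿ (-ᴿ y)

------------------------------------------------------------------------
-- Natural logarithm of a positive integer

∑< : ℕ → (ℕ → ℚ) → ℚ
∑< zero    f = 0ℚ
∑< (suc c) f = ∑< c f + f c

infix 7 ∑<

syntax ∑< c (λ j → e) = ∑[ j < c ] e

-- log n = ∫₁ⁿ dt/t.  With N = i+1, the lower Riemann sum on the uniform
-- partition of [1,n] of mesh 1/N is
--   ∑_{1≤j≤(n-1)N} (1/N)·1/(1+j/N) = ∑_{1≤j≤(n-1)N} 1/(N+j),
-- and it differs from the integral by at most 1/N.

logApprox : ℕ → ℕ → ℚ
logApprox n i = ∑[ j < pred n ℕ.* suc i ] 1/1+ (suc i ℕ.+ j)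

∑-mono : ∀ c {f g : ℕ → ℚ} → (∀ j → j ℕ.< c → f j ≤ g j) → ∑< c f ≤ ∑< c g
∑-mono zero    f≤g = ℚ.≤-refl
∑-mono (suc c) f≤g = ℚ.+-mono-≤ (∑-mono c λ j j<c → f≤g j (ℕ.m<n⇒m<1+n j<c)) (f≤g c (ℕ.n<1+n c))

∑-cong : ∀ c {f g : ℕ → ℚ} → (∀ j → f j ≡ g j) → ∑< c f ≡ ∑< c g
∑-cong zero    f≡g = refl
∑-cong (suc c) f≡g = cong₂ _+_ (∑-cong c f≡g) (f≡g c)

∑-const : ∀ c q → ∑[ j < c ] q ≡ (+ c / 1) * q
∑-const zero    q = sym (ℚ.*-zeroˡ q)
∑-const (suc c) q = begin
  ∑[ j < c ] q + q            ≡⟨ cong₂ _+_ (∑-const c q) (sym (ℚ.*-identityˡ q)) ⟩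
  (+ c / 1) * q + 1ℚ * q      ≡⟨ sym (ℚ.*-distribʳ-+ q (+ c / 1) 1ℚ) ⟩
  ((+ c / 1) + 1ℚ) * q        ≡⟨ cong (_* q) suc-/1 ⟩
  (+ suc c / 1) * q           ∎
  where
  open ≡-Reasoning
  suc-/1 : (+ c / 1) + 1ℚ ≡ + suc c / 1
  suc-/1 = ℚ.toℚᵘ-injective (begin′
    toℚᵘ ((+ c / 1) + 1ℚ)             ≃⟨ ℚ.toℚᵘ-homo-+ (+ c / 1) 1ℚ ⟩
    toℚᵘ (+ c / 1) ℚᵘ.+ toℚᵘ 1ℚ       ≃⟨ ℚᵘ.+-congˡ (toℚᵘ 1ℚ) (ℚ.toℚᵘ-fromℚᵘ (mkℚᵘ (+ c) 0)) ⟩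
    mkℚᵘ (+ c) 0 ℚᵘ.+ mkℚᵘ (+ 1) 0    ≃⟨ *≡* (trans (ℤ.*-identityʳ _) (trans (cong (ℤ._+ + 1) (ℤ.*-identityʳ (+ c))) (trans (cong +_ (ℕ.+-comm c 1)) (sym (ℤ.*-identityʳ (+ suc c)))))) ⟩
    mkℚᵘ (+ suc c) 0                  ≃⟨ ℚᵘ.≃-sym (ℚ.toℚᵘ-fromℚᵘ (mkℚᵘ (+ suc c) 0)) ⟩
    toℚᵘ (+ suc c / 1)                ∎′)
    where
    open ℚᵘ.≤-Reasoning using (step-≃-⟩) renaming (begin-equality_ to begin′_; _∎ to _∎′)

∑-split : ∀ a b f → ∑< (a ℕ.+ b) f ≡ ∑< a f + ∑[ j < b ] f (a ℕ.+ j)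
∑-split a zero    f = trans (cong (λ c → ∑< c f) (ℕ.+-identityʳ a)) (sym (ℚ.+-identityʳ (∑< a f)))
∑-split a (suc b) f = trans (cong (λ c → ∑< c f) (ℕ.+-suc a b))
  (trans (cong (_+ f (a ℕ.+ b)) (∑-split a b f)) (ℚ.+-assoc (∑< a f) _ _))

∑-blocks : ∀ c M f → ∑< (c ℕ.* M) f ≡ ∑[ b < c ] (∑[ j < M ] f (b ℕ.* M ℕ.+ j))
∑-blocks zero    M f = refl
∑-blocks (suc c) M f = trans (cong (λ d → ∑< d f) (ℕ.+-comm M (c ℕ.* M)))
  (trans (∑-split (c ℕ.* M) M f) (cong (_+ ∑[ j < M ] f (c ℕ.* M ℕ.+ j)) (∑-blocks c M f)))

∑-telescope : ∀ c i → ∑[ b < c ] 1/1+ (i ℕ.+ b) + 1/1+ (i ℕ.+ c) ≡ ∑[ b < c ] 1/1+ (suc i ℕ.+ b) + 1/1+ i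
∑-telescope zero    i = cong (λ x → 0ℚ + 1/1+ x) (ℕ.+-identityʳ i)
∑-telescope (suc c) i = begin
  S + 1/1+ (i ℕ.+ c) + 1/1+ (i ℕ.+ suc c)     ≡⟨ cong₂ _+_ (∑-telescope c i) (cong 1/1+_ (ℕ.+-suc i c)) ⟩
  T + 1/1+ i + 1/1+ (suc i ℕ.+ c)             ≡⟨ solve 3 (λ t u v → t :+ u :+ v := t :+ v :+ u) refl T (1/1+ i) (1/1+ (suc i ℕ.+ c)) ⟩
  T + 1/1+ (suc i ℕ.+ c) + 1/1+ i             ∎
  where
  open ≡-Reasoning
  open ℚ-Solver
  S = ∑[ b < c ] 1/1+ (i ℕ.+ b)
  T = ∑[ b < c ] 1/1+ (suc i ℕ.+ b)

-- index of the precision 1/((i+1)(j+1))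
refine : ℕ → ℕ → ℕ
refine i j = j ℕ.+ i ℕ.* suc j

refine-blocks : ∀ n i j → logApprox n (refine i j)
  ≡ ∑[ b < pred n ℕ.* suc i ] (∑[ l < suc j ] 1/1+ ((suc i ℕ.+ b) ℕ.* suc j ℕ.+ l))
refine-blocks n i j = begin
  ∑[ l < pred n ℕ.* (suc i ℕ.* suc j) ] 1/1+ (suc i ℕ.* suc j ℕ.+ l)
    ≡⟨ cong (λ c → ∑[ l < c ] 1/1+ (suc i ℕ.* suc j ℕ.+ l)) (sym (ℕ.*-assoc (pred n) (suc i) (suc j))) ⟩
  ∑[ l < pred n ℕ.* suc i ℕ.* suc j ] 1/1+ (suc i ℕ.* suc j ℕ.+ l)
    ≡⟨ ∑-blocks (pred n ℕ.* suc i) (suc j) _ ⟩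
  ∑[ b < pred n ℕ.* suc i ] (∑[ l < suc j ] 1/1+ (suc i ℕ.* suc j ℕ.+ (b ℕ.* suc j ℕ.+ l)))
    ≡⟨ ∑-cong (pred n ℕ.* suc i) (λ b → ∑-cong (suc j) (λ l → cong 1/1+_ (regroup b l))) ⟩
  ∑[ b < pred n ℕ.* suc i ] (∑[ l < suc j ] 1/1+ ((suc i ℕ.+ b) ℕ.* suc j ℕ.+ l)) ∎
  where
  open ≡-Reasoning
  regroup : ∀ b l → suc i ℕ.* suc j ℕ.+ (b ℕ.* suc j ℕ.+ l) ≡ (suc i ℕ.+ b) ℕ.* suc j ℕ.+ l
  regroup b l = trans (sym (ℕ.+-assoc (suc i ℕ.* suc j) _ l)) (cong (ℕ._+ l) (sym (ℕ.*-distribʳ-+ (suc j) (suc i) b)))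

block-lower : ∀ a j → 1/1+ suc a ≤ ∑[ l < suc j ] 1/1+ (suc a ℕ.* suc j ℕ.+ l)
block-lower a j = subst (_≤ ∑[ l < suc j ] 1/1+ (suc a ℕ.* suc j ℕ.+ l))
  (trans (∑-const (suc j) _) (scale-1/1+ j (suc a) (suc a ℕ.* suc j ℕ.+ j) count))
  (∑-mono (suc j) λ l l<1+j → 1/1+-anti (ℕ.+-monoʳ-≤ (suc a ℕ.* suc j) (ℕ.s≤s⁻¹ l<1+j)))
  where
  open +-*-Solver
  count : suc j ℕ.* suc (suc a) ≡ suc (suc a ℕ.* suc j ℕ.+ j)
  count = solve 2 (λ a j → (con 1 :+ j) :* (con 2 :+ a) := con 1 :+ ((con 1 :+ a) :* (con 1 :+ j) :+ j)) refl a j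

block-upper : ∀ a j → ∑[ l < suc j ] 1/1+ (suc a ℕ.* suc j ℕ.+ l) ≤ 1/1+ a
block-upper a j = subst (∑[ l < suc j ] 1/1+ (suc a ℕ.* suc j ℕ.+ l) ≤_)
  (trans (∑-const (suc j) _) (scale-1/1+ j a (refine a j) (ℕ.*-comm (suc j) (suc a))))
  (∑-mono (suc j) λ l _ → 1/1+-anti (ℕ.≤-trans (ℕ.n≤1+n (refine a j)) (ℕ.m≤m+n (suc a ℕ.* suc j) l)))

log-refine-lower : ∀ n i j → logApprox n i ≤ logApprox n (refine i j)
log-refine-lower n i j = subst (logApprox n i ≤_) (sym (refine-blocks n i j))
  (∑-mono (pred n ℕ.* suc i) λ b _ → block-lower (i ℕ.+ b) j)

log-refine-upper : ∀ n i j → logApprox n (refine i j) ≤ logApprox n i + 1/1+ i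
log-refine-upper n i j = begin
  logApprox n (refine i j)                                     ≡⟨ refine-blocks n i j ⟩
  ∑[ b < c ] (∑[ l < suc j ] 1/1+ ((suc i ℕ.+ b) ℕ.* suc j ℕ.+ l)) ≤⟨ ∑-mono c (λ b _ → block-upper (i ℕ.+ b) j) ⟩
  S                                                            ≡⟨ sym (ℚ.+-identityʳ S) ⟩
  S + 0ℚ                                                       ≤⟨ ℚ.+-monoʳ-≤ S (0≤1/1+ (i ℕ.+ c)) ⟩
  S + 1/1+ (i ℕ.+ c)                                           ≡⟨ ∑-telescope c i ⟩
  logApprox n i + 1/1+ i                                       ∎
  where
  open ℚ.≤-Reasoning
  c = pred n ℕ.* suc i
  S = ∑[ b < c ] 1/1+ (i ℕ.+ b)

refine-comm : ∀ i j → refine i j ≡ refine j i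
refine-comm i j = ℕ.suc-injective (ℕ.*-comm (suc i) (suc j))

log-diff : ∀ n i j → logApprox n i - logApprox n j ≤ 1/1+ i + 1/1+ j
log-diff n i j = begin
  x - y                  ≤⟨ ℚ.+-monoˡ-≤ (- y) (ℚ.≤-trans (log-refine-lower n i j) (subst (λ r → logApprox n r ≤ y + v) (refine-comm j i) (log-refine-upper n j i))) ⟩
  (y + v) - y            ≡⟨ solve 2 (λ y v → (y :+ v) :- y := con 0ℚ :+ v) refl y v ⟩
  0ℚ + v                 ≤⟨ ℚ.+-monoˡ-≤ v (0≤1/1+ i) ⟩
  1/1+ i + v             ∎
  where
  open ℚ.≤-Reasoning
  open ℚ-Solver
  x = logApprox n i
  y = logApprox n j
  v = 1/1+ j

log : (n : ℕ) → .{{NonZero n}} → ℝ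
log n .approx = logApprox n
log n .regular i j with ℚ.∣p∣≡p∨∣p∣≡-p (logApprox n i - logApprox n j)
... | inj₁ eq = subst (_≤ 1/1+ i + 1/1+ j) (sym eq) (log-diff n i j)
... | inj₂ eq = subst₂ _≤_ (trans (flip (logApprox n i) (logApprox n j)) (sym eq)) (ℚ.+-comm (1/1+ j) (1/1+ i)) (log-diff n j i)
  where
  open ℚ-Solver
  flip : ∀ x y → y - x ≡ - (x - y)
  flip = solve 2 (λ x y → y :- x := :- (x :- y)) refl

------------------------------------------------------------------------
-- Limits

_⟶∞ : (ℕ → ℝ) → Set
ω ⟶∞ = ∀ (K : ℚ) → ∃ λ N → ∀ n → N ℕ.≤ n → fromℚ K ≤ᴿ ω n

_⟶_ : (ℕ → ℚ) → ℚ → Set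
a ⟶ L = ∀ (ε : ℚ) → 0ℚ < ε → ∃ λ N → ∀ n → N ℕ.≤ n → ℚ.∣ a n - L ∣ < ε

infix 4 _⟶∞ _⟶_

------------------------------------------------------------------------
-- Graphs

record Graph (n : ℕ) : Set₁ where
  field
    Adj    : Rel (Fin n) 0ℓ
    irrefl : ∀ {u} → ¬ Adj u u
    symm   : ∀ {u v} → Adj u v → Adj v u
    adj?   : Decidable₂ Adj

open Graph public

Isolated : ∀ {n} → Graph n → Pred (Fin n) 0ℓ
Isolated G v = ∀ u → ¬ Adj G v u

HasIsolatedVertex : ∀ {n} → Pred (Graph n) 0ℓ
HasIsolatedVertex G = ∃ λ v → Isolated G v

NoIsolatedVertex : ∀ {n} → Pred (Graph n) 0ℓ
NoIsolatedVertex G = ¬ HasIsolatedVertex G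

hasIsolatedVertex? : ∀ {n} → Decidable (HasIsolatedVertex {n})
hasIsolatedVertex? G = Fin.any? λ v → Fin.all? λ u → ¬? (adj? G v u)

noIsolatedVertex? : ∀ {n} → Decidable (NoIsolatedVertex {n})
noIsolatedVertex? G = ¬? (hasIsolatedVertex? G)

intersectionGraph : ∀ {n m} → Vec (Subset m) n → Graph n
intersectionGraph F .Adj u v = u ≢ v × Nonempty (lookup F u ∩ lookup F v)
intersectionGraph F .irrefl (u≢u , _) = u≢u refl
intersectionGraph F .symm {u} {v} (u≢v , ne) = (λ v≡u → u≢v (sym v≡u)) , subst Nonempty (∩-comm (lookup F u) (lookup F v)) ne
intersectionGraph F .adj? u v = ¬? (u Fin.≟ v) ×-dec nonempty? (lookup F u ∩ lookup F v)

------------------------------------------------------------------------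
-- The random graph G(n,m,k)

subsets : ∀ m → List (Subset m)
subsets zero    = [] ∷ []
subsets (suc m) = map (inside ∷_) (subsets m) ++ map (outside ∷_) (subsets m)

kSubsets : ∀ m k → List (Subset m)
kSubsets m k = filter (λ S → ∣ S ∣ ℕ.≟ k) (subsets m)

tuples : ∀ {A : Set} n → List A → List (Vec A n)
tuples zero    xs = [] ∷ []
tuples (suc n) xs = cartesianProductWith _∷_ xs (tuples n xs)

-- Each outcome occurs exactly once; independent uniform choices of the
-- F_v amount to the uniform distribution on this list.
assignments : ∀ n m k → List (Vec (Subset m) n)
assignments n m k = tuples n (kSubsets m k)

∈-subsets : ∀ {m} (S : Subset m) → S ∈ subsets m
∈-subsets [] = here refl
∈-subsets {suc m} (inside ∷ S)  = ∈-++⁺ˡ (∈-map⁺ (inside ∷_) (∈-subsets S))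
∈-subsets {suc m} (outside ∷ S) = ∈-++⁺ʳ (map (inside ∷_) (subsets m)) (∈-map⁺ (outside ∷_) (∈-subsets S))

kSubset : ∀ {m k} → k ℕ.≤ m → ∃ λ (S : Subset m) → ∣ S ∣ ≡ k
kSubset {m} ℕ.z≤n = ⊥ , ∣⊥∣≡0 m
kSubset (ℕ.s≤s k≤m) with kSubset k≤m
... | S , eq = inside ∷ S , cong suc eq

tuple : ∀ {A : Set} n {x : A} {xs} → x ∈ xs → ∃ λ t → t ∈ tuples n xs
tuple zero    x∈xs = [] , here refl
tuple (suc n) x∈xs with tuple n x∈xs
... | _ , t∈ = _ , ∈-cartesianProductWith⁺ _∷_ x∈xs t∈

assignments-nonZero : ∀ n {m k} → k ℕ.≤ m → NonZero (length (assignments n m k))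
assignments-nonZero n {m} {k} k≤m with kSubset k≤m
... | S , eq = ℕ.>-nonZero (∈-length (proj₂ (tuple n (∈-filter⁺ (λ T → ∣ T ∣ ℕ.≟ k) (∈-subsets S) eq))))

Pr : ∀ {A : Set} (Ω : List A) → .{{NonZero (length Ω)}} → (E : Pred A 0ℓ) → Decidable E → ℚ
Pr Ω E E? = + length (filter E? Ω) / length Ω

PrG : ∀ n m k → k ℕ.≤ m → (E : Pred (Graph n) 0ℓ) → Decidable E → ℚ
PrG n m k k≤m E E? = Pr (assignments n m k) {{assignments-nonZero n k≤m}}
  (λ F → E (intersectionGraph F)) (λ F → E? (intersectionGraph F))

AsymptoticallyAlmostSurely : (m k : ℕ → ℕ) → (∀ n → k n ℕ.≤ m n) →
  (E : ∀ {n} → Pred (Graph n) 0ℓ) → (∀ {n} → Decidable (E {n})) → Set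
AsymptoticallyAlmostSurely m k k≤m E E? = (λ n → PrG n (m n) (k n) (k≤m n) E E?) ⟶ 1ℚ

{-# OPTIONS --safe #-}
module Submission where

-- Write T, α, β for the number of k-subsets of M that avoid a given set of
-- size 0, k, 2k, and X for the number of isolated vertices.  Then
-- E X = n (α/T)ⁿ⁻¹ and E X(X-1) = n(n-1) (α/T) (β/T)ⁿ⁻².
--
-- Above the threshold α/T ≤ (1 - k/m)ᵏ, so E X → 0.  Below it
-- 1 - α/T ≤ k²/m, so E X → ∞, and βT ≤ α² turns Chebyshev's inequality into
-- P(X = 0) ≤ 1/E X + (T/α - 1) → 0.
--
-- The exponential function is never needed: n and 1/n are, up to constant
-- factors, the products of 1 + 1/(j+3) and of 1 - 1/(j+3) over j < 2(n-1), and
-- the deviations of these factors from 1 add up to ± the mesh-1/2 approximation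
-- of log n.  Hence n (1 - k/m)ᵏ⁽ⁿ⁻¹⁾ and
-- n⁻¹ (T/α)ⁿ⁻¹ are products of nonnegative numbers whose deviations from 1 add up
-- to at most -K, and such a product is at most 1/(1 + K) by AM-GM.

-- Three error terms shape the estimates. First, `log n` is a Bishop real, and the hypothesis is
-- read at a single precision: at index 0 a sum of reals evaluates its summands at index 1, which is
-- exactly the mesh-1/2 sum. All bounded errors are then charged to ω, which exceeds every constant.
-- With this mesh the product of 1 - 1/(j+3) over j < 2(n-1) is 1/n exactly. Second, the moments
-- contain n-1 where the hypothesis contains n. Above the threshold k²/m has no a priori upper
-- bound, so the difference is paid for by demanding about twice the surplus that is finally used.
-- Third, below the threshold put z = k²/m. Then 1 - α/T ≤ z only gives T/α - 1 ≤ z + 2z², and the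
-- second-order term is multiplied by n. It stays bounded because nz is at most the approximate
-- logarithm H, and H² ≤ 3(n-1). The same bound forces z → 0, hence T/α → 1, and also 2k ≤ m, so
-- that α is nonzero. In Chebyshev's inequality, βT ≤ α² gives E X(X-1) ≤ (T/α)(E X)², which is
-- where the term T/α - 1 originates.

open import Defs
open import Algebra.Bundles using (module CommutativeRing)
open import Data.Bool.Base using (if_then_else_; true; false)
open import Data.Fin.Base using (Fin; zero; suc; punchIn; punchOut)
import Data.Fin.Properties as Fin
open import Data.Fin.Subset using (Subset; inside; outside; _∩_; _∪_; ∣_∣; Nonempty; ⊥)
open import Data.Fin.Subset.Properties using (nonempty?; ∉⊥; ∣⊥∣≡0; ∣p∣≤n; x∈p∪q⁻; x∈p∪q⁺; x∈p∩q⁺; x∈p∩q⁻)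
import Data.Integer.Base as ℤ
import Data.Integer.Properties as ℤ
open import Data.List.Base using (List; []; _∷_; _++_; map; filter; length; cartesianProductWith; allFin)
open import Data.List.Membership.Propositional using (_∈_)
open import Data.List.Membership.Propositional.Properties using (∈-filter⁻)
import Data.List.Properties as List
open import Data.List.Relation.Unary.Any using (here; there)
open import Data.Nat.Base as ℕ using (ℕ; zero; suc; NonZero)
open import Data.Nat.Combinatorics using (_C_; nCk+nC[k+1]≡[n+1]C[k+1]; nC1≡n; k>n⇒nCk≡0)
open import Data.Nat.ListAction using (sum)
import Data.Nat.Properties as ℕ
open import Data.Nat.Solver using () renaming (module +-*-Solver to ℕ-Solver)
open import Data.Product.Base using (∃; _×_; _,_; proj₁; proj₂)
open import Data.Rational.Base as ℚ using (ℚ; 0ℚ; 1ℚ; toℚᵘ)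
import Data.Rational.Properties as ℚ
open import Data.Rational.Solver using () renaming (module +-*-Solver to ℚ-Solver)
open import Data.Rational.Unnormalised.Base as ℚᵘ using (mkℚᵘ; *≤*; *≡*)
import Data.Rational.Unnormalised.Properties as ℚᵘ
open import Data.Sum.Base using (inj₁; inj₂)
open import Data.Vec.Base as Vec using (Vec; []; _∷_; lookup; insertAt)
open import Data.Vec.Properties using (insertAt-lookup; insertAt-punchIn)
open import Function.Base using (_∘_; id)
open import Level using (0ℓ)
open import Relation.Binary.PropositionalEquality
open import Relation.Nullary using (Dec; does; yes; no; ¬_; ¬?; _×-dec_; contradiction)
open import Relation.Unary using (Pred; Decidable)
import Algebra.Properties.CommutativeSemiring.Exp (CommutativeRing.commutativeSemiring ℚ.+-*-commutativeRing) as Exp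

-- Binomial coefficients

module _ where
  open import Data.Nat.Base using (_+_; _*_; _^_; _∸_; _≤_; _<_)

  pascal : ∀ n k → suc n C suc k ≡ n C k + n C suc k
  pascal n k = sym (nCk+nC[k+1]≡[n+1]C[k+1] n k)

  -- Double counting of pairs of a k-set and a point: a point inside gives `k * (n C k)`, a point
  -- outside gives a (k+1)-set with a marked element. The form without subtraction lets Pascal's
  -- rule carry the induction with no case distinction on k ≤ n.
  C-step : ∀ n k → suc k * (n C suc k) + k * (n C k) ≡ n * (n C k)
  C-step zero zero = refl
  C-step zero (suc k) = cong₂ _+_
    (trans (cong (suc (suc k) *_) (k>n⇒nCk≡0 {0} {suc (suc k)} ℕ.z<s)) (ℕ.*-zeroʳ (suc (suc k))))
    (trans (cong (suc k *_) (k>n⇒nCk≡0 {0} {suc k} ℕ.z<s)) (ℕ.*-zeroʳ (suc k)))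
  C-step (suc n) zero = begin
    1 * (suc n C 1) + 0        ≡⟨ ℕ.+-identityʳ _ ⟩
    1 * (suc n C 1)            ≡⟨ trans (ℕ.*-identityˡ (suc n C 1)) (nC1≡n (suc n)) ⟩
    suc n                      ≡⟨ ℕ.*-identityʳ (suc n) ⟨
    suc n * 1                  ∎
    where open ≡-Reasoning
  C-step (suc n) (suc k) = begin
    (2 + k) * (suc n C (2 + k)) + (1 + k) * (suc n C (1 + k))
      ≡⟨ cong₂ (λ s t → (2 + k) * s + (1 + k) * t) (pascal n (suc k)) (pascal n k) ⟩
    (2 + k) * (b + c) + (1 + k) * (a + b)
      ≡⟨ solve 4 (λ k a b c → (con 2 :+ k) :* (b :+ c) :+ (con 1 :+ k) :* (a :+ b) := ((con 2 :+ k) :* c :+ (con 1 :+ k) :* b) :+ b :+ ((con 1 :+ k) :* b :+ k :* a) :+ a) refl k a b c ⟩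
    ((2 + k) * c + (1 + k) * b) + b + ((1 + k) * b + k * a) + a
      ≡⟨ cong₂ (λ s t → s + b + t + a) (C-step n (suc k)) (C-step n k) ⟩
    n * b + b + n * a + a
      ≡⟨ solve 3 (λ n a b → n :* b :+ b :+ n :* a :+ a := (con 1 :+ n) :* (a :+ b)) refl n a b ⟩
    suc n * (a + b)
      ≡⟨ cong (suc n *_) (sym (pascal n k)) ⟩
    suc n * (suc n C suc k) ∎
    where
    open ≡-Reasoning
    open ℕ-Solver
    a = n C k
    b = n C suc k
    c = n C suc (suc k)

  C-suc : ∀ n k → suc k * (n C suc k) ≡ (n ∸ k) * (n C k)
  C-suc n k = begin
    suc k * (n C suc k)                              ≡⟨ ℕ.m+n∸n≡m (suc k * (n C suc k)) (k * (n C k)) ⟨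
    suc k * (n C suc k) + k * (n C k) ∸ k * (n C k)  ≡⟨ cong (_∸ k * (n C k)) (C-step n k) ⟩
    n * (n C k) ∸ k * (n C k)                        ≡⟨ ℕ.*-distribʳ-∸ (n C k) n k ⟨
    (n ∸ k) * (n C k)                                ∎
    where open ≡-Reasoning

  absorption : ∀ n k → suc k * (suc n C suc k) ≡ suc n * (n C k)
  absorption n k = begin
    suc k * (suc n C suc k)                       ≡⟨ cong (suc k *_) (pascal n k) ⟩
    suc k * (n C k + n C suc k)                   ≡⟨ solve 3 (λ k a b → (con 1 :+ k) :* (a :+ b) := a :+ ((con 1 :+ k) :* b :+ k :* a)) refl k (n C k) (n C suc k) ⟩
    n C k + (suc k * (n C suc k) + k * (n C k))   ≡⟨ cong (n C k +_) (C-step n k) ⟩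
    suc n * (n C k)                               ∎
    where
    open ≡-Reasoning
    open ℕ-Solver

  C-pos : ∀ {n k} → k ≤ n → NonZero (n C k)
  C-pos {k = zero} _ = _
  C-pos {suc n} {suc k} (ℕ.s≤s k≤n) =
    subst NonZero (sym (pascal n k)) (ℕ.>-nonZero (ℕ.≤-trans (ℕ.>-nonZero⁻¹ (n C k) {{C-pos k≤n}}) (ℕ.m≤m+n (n C k) (n C suc k))))

  C-mono-suc : ∀ n k → n C k ≤ suc n C k
  C-mono-suc n zero    = ℕ.≤-refl
  C-mono-suc n (suc k) = subst (n C suc k ≤_) (sym (pascal n k)) (ℕ.m≤n+m (n C suc k) (n C k))

  C-mono : ∀ n s k → n C k ≤ (n + s) C k
  C-mono n zero    k = ℕ.≤-reflexive (cong (_C k) (sym (ℕ.+-identityʳ n)))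
  C-mono n (suc s) k = ℕ.≤-trans (C-mono n s k) (subst (λ t → (n + s) C k ≤ t C k) (sym (ℕ.+-suc n s)) (C-mono-suc (n + s) k))

  -- Factor by factor, (a - i)/(b - i) ≤ a/b for a ≤ b, so the quotient of the binomials is at most
  -- (a/b)ᵏ. With a = m - k and b = m this bounds α/T by (1 - k/m)ᵏ.
  C-ratio : ∀ {a b} k → a ≤ b → (a C k) * b ^ k ≤ a ^ k * (b C k)
  C-ratio zero a≤b = ℕ.≤-refl
  C-ratio {a} {b} (suc k) a≤b = ℕ.*-cancelˡ-≤ (suc k) (begin
    suc k * ((a C suc k) * (b * b ^ k))        ≡⟨ ℕ.*-assoc (suc k) (a C suc k) (b * b ^ k) ⟨
    suc k * (a C suc k) * (b * b ^ k)          ≡⟨ cong (_* (b * b ^ k)) (C-suc a k) ⟩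
    (a ∸ k) * (a C k) * (b * b ^ k)            ≡⟨ solve 4 (λ x y z w → x :* y :* (z :* w) := x :* z :* (y :* w)) refl (a ∸ k) (a C k) b (b ^ k) ⟩
    (a ∸ k) * b * ((a C k) * b ^ k)            ≤⟨ ℕ.*-mono-≤ factor (C-ratio k a≤b) ⟩
    a * (b ∸ k) * (a ^ k * (b C k))            ≡⟨ solve 4 (λ x y z w → x :* y :* (z :* w) := x :* z :* (y :* w)) refl a (b ∸ k) (a ^ k) (b C k) ⟩
    a * a ^ k * ((b ∸ k) * (b C k))            ≡⟨ cong (a * a ^ k *_) (sym (C-suc b k)) ⟩
    a * a ^ k * (suc k * (b C suc k))          ≡⟨ solve 3 (λ x y z → x :* (y :* z) := y :* (x :* z)) refl (a * a ^ k) (suc k) (b C suc k) ⟩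
    suc k * (a * a ^ k * (b C suc k))          ∎)
    where
    open ℕ.≤-Reasoning
    open ℕ-Solver
    factor : (a ∸ k) * b ≤ a * (b ∸ k)
    factor = subst₂ _≤_ (sym (ℕ.*-distribʳ-∸ b a k)) (sym (ℕ.*-distribˡ-∸ a b k))
      (ℕ.∸-monoʳ-≤ (a * b) (subst (a * k ≤_) (ℕ.*-comm b k) (ℕ.*-monoˡ-≤ k a≤b)))

  -- Factor by factor, e(e + 2s) ≤ (e + s)² with e = t - i. For t = m - 2k and s = k this is βT ≤
  -- α².
  C-log-concave : ∀ t s k → (t C k) * ((t + s + s) C k) ≤ ((t + s) C k) * ((t + s) C k)
  C-log-concave t s zero    = ℕ.≤-refl
  C-log-concave t s (suc k) = ℕ.*-cancelˡ-≤ (suc k * suc k) (begin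
    suc k * suc k * (x′ * z′)                        ≡⟨ swap (suc k) (suc k) x′ z′ ⟩
    (suc k * x′) * (suc k * z′)                      ≡⟨ cong₂ _*_ (C-suc t k) (C-suc (t + s + s) k) ⟩
    ((t ∸ k) * x) * ((t + s + s ∸ k) * z)            ≡⟨ swap (t ∸ k) (t + s + s ∸ k) x z ⟨
    (t ∸ k) * (t + s + s ∸ k) * (x * z)              ≤⟨ ℕ.*-mono-≤ factor (C-log-concave t s k) ⟩
    (t + s ∸ k) * (t + s ∸ k) * (y * y)              ≡⟨ swap (t + s ∸ k) (t + s ∸ k) y y ⟩
    ((t + s ∸ k) * y) * ((t + s ∸ k) * y)            ≡⟨ cong₂ _*_ (C-suc (t + s) k) (C-suc (t + s) k) ⟨
    (suc k * y′) * (suc k * y′)                      ≡⟨ swap (suc k) (suc k) y′ y′ ⟨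
    suc k * suc k * (y′ * y′)                        ∎)
    where
    open ℕ.≤-Reasoning
    open ℕ-Solver
    x = t C k
    y = (t + s) C k
    z = (t + s + s) C k
    x′ = t C suc k
    y′ = (t + s) C suc k
    z′ = (t + s + s) C suc k
    swap : ∀ a b c d → a * b * (c * d) ≡ (a * c) * (b * d)
    swap = solve 4 (λ a b c d → a :* b :* (c :* d) := (a :* c) :* (b :* d)) refl
    factor : (t ∸ k) * (t + s + s ∸ k) ≤ (t + s ∸ k) * (t + s ∸ k)
    factor with k ℕ.≤? t
    -- Truncated subtraction makes the left side vanish here.
    ... | no  k≰t = subst (λ e → e * (t + s + s ∸ k) ≤ (t + s ∸ k) * (t + s ∸ k)) (sym (ℕ.m≤n⇒m∸n≡0 (ℕ.≰⇒≥ k≰t))) ℕ.z≤n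
    ... | yes k≤t = begin
      (t ∸ k) * (t + s + s ∸ k)           ≡⟨ cong ((t ∸ k) *_) (trans (ℕ.+-∸-comm s (ℕ.≤-trans k≤t (ℕ.m≤m+n t s))) (cong (_+ s) (ℕ.+-∸-comm s k≤t))) ⟩
      (t ∸ k) * (t ∸ k + s + s)           ≤⟨ ℕ.m≤m+n _ (s * s) ⟩
      (t ∸ k) * (t ∸ k + s + s) + s * s   ≡⟨ solve 2 (λ e s → e :* (e :+ s :+ s) :+ s :* s := (e :+ s) :* (e :+ s)) refl (t ∸ k) s ⟩
      (t ∸ k + s) * (t ∸ k + s)           ≡⟨ cong₂ _*_ (ℕ.+-∸-comm s k≤t) (ℕ.+-∸-comm s k≤t) ⟨
      (t + s ∸ k) * (t + s ∸ k)           ∎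

  -- Union bound over `suc s` marked points: a (k+1)-set avoids them all or contains one of them,
  -- and each lies in `(t + s) C k` of the sets. Pascal's rule peels off one marked point at a time.
  C-union-bound : ∀ t s k → (t + suc s) C suc k ≤ t C suc k + suc s * ((t + s) C k)
  C-union-bound t s k = subst (λ e → e C suc k ≤ t C suc k + suc s * ((t + s) C k)) (sym (ℕ.+-suc t s)) (begin
    suc (t + s) C suc k                               ≡⟨ pascal (t + s) k ⟩
    (t + s) C k + (t + s) C suc k                     ≤⟨ ℕ.+-monoʳ-≤ ((t + s) C k) (rest s) ⟩
    (t + s) C k + (t C suc k + s * ((t + s) C k))     ≡⟨ solve 3 (λ a b c → a :+ (b :+ c) := b :+ (a :+ c)) refl ((t + s) C k) (t C suc k) (s * ((t + s) C k)) ⟩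
    t C suc k + suc s * ((t + s) C k)                 ∎)
    where
    open ℕ.≤-Reasoning
    open ℕ-Solver
    rest : ∀ s → (t + s) C suc k ≤ t C suc k + s * ((t + s) C k)
    rest zero    = ℕ.≤-reflexive (trans (cong (_C suc k) (ℕ.+-identityʳ t)) (sym (ℕ.+-identityʳ (t C suc k))))
    rest (suc s) = ℕ.≤-trans (C-union-bound t s k)
      (ℕ.+-monoʳ-≤ (t C suc k) (ℕ.*-monoʳ-≤ (suc s) (subst (λ e → (t + s) C k ≤ e C k) (sym (ℕ.+-suc t s)) (C-mono-suc (t + s) k))))

  -- The union bound gives T ≤ α + k C(m-1, k-1), and absorption turns C(m-1, k-1) into (k/m) T.
  -- This is 1 - α/T ≤ k²/m multiplied out.
  C-disjoint-bound : ∀ {m} k .{{_ : NonZero k}} → k ≤ m → m * (m C k) ≤ m * ((m ∸ k) C k) + k * k * (m C k)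
  C-disjoint-bound {m} k@(suc i) k≤m = begin
    m * (m C k)                                ≡⟨ cong (λ e → m * (e C k)) t+k≡m ⟨
    m * ((t + k) C k)                          ≤⟨ ℕ.*-monoʳ-≤ m (C-union-bound t i i) ⟩
    m * (t C k + k * ((t + i) C i))            ≡⟨ solve 4 (λ m a k b → m :* (a :+ k :* b) := m :* a :+ k :* (m :* b)) refl m (t C k) k ((t + i) C i) ⟩
    m * (t C k) + k * (m * ((t + i) C i))      ≡⟨ cong (λ e → m * (t C k) + k * e) absorb ⟩
    m * (t C k) + k * (k * (m C k))            ≡⟨ cong (m * (t C k) +_) (ℕ.*-assoc k k (m C k)) ⟨
    m * (t C k) + k * k * (m C k)              ∎
    where
    open ℕ.≤-Reasoning
    open ℕ-Solver
    t = m ∸ k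
    t+k≡m : t + k ≡ m
    t+k≡m = ℕ.m∸n+n≡m k≤m
    absorb : m * ((t + i) C i) ≡ k * (m C k)
    absorb = subst (λ e → e * ((t + i) C i) ≡ k * (e C k)) (trans (sym (ℕ.+-suc t i)) t+k≡m) (sym (absorption (t + i) i))

-- Counting by summation over lists

module _ where
  open import Data.Nat.Base using (_+_; _*_; _^_; _∸_; _≤_; _<_)

  private variable
    A B : Set
    P Q : Set

  -- Going through `does` makes the value depend on the Boolean alone, so that the indicators of
  -- `suc a ≟ suc b` and `a ≟ b` agree by computation; the induction in `∑-avoiding` relies on this.
  𝟙 : Dec P → ℕ
  𝟙 d = if does d then 1 else 0

  𝟙-true : (d : Dec P) → P → 𝟙 d ≡ 1
  𝟙-true (yes _) p = refl
  𝟙-true (no ¬p) p = contradiction p ¬p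

  𝟙-false : (d : Dec P) → ¬ P → 𝟙 d ≡ 0
  𝟙-false (yes p) ¬p = contradiction p ¬p
  𝟙-false (no _)  ¬p = refl

  𝟙-mono : (d : Dec P) (e : Dec Q) → (P → Q) → 𝟙 d ≤ 𝟙 e
  𝟙-mono (no _)  e f = ℕ.z≤n
  𝟙-mono (yes p) e f = ℕ.≤-reflexive (sym (𝟙-true e (f p)))

  𝟙-cong : (d : Dec P) (e : Dec Q) → (P → Q) → (Q → P) → 𝟙 d ≡ 𝟙 e
  𝟙-cong d e f g = ℕ.≤-antisym (𝟙-mono d e f) (𝟙-mono e d g)

  𝟙-× : (d : Dec P) (e : Dec Q) → 𝟙 (d ×-dec e) ≡ 𝟙 d * 𝟙 e
  𝟙-× (yes _) (yes _) = refl
  𝟙-× (yes _) (no _)  = refl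
  𝟙-× (no _)  _       = refl

  𝟙-¬ : (d : Dec P) → 𝟙 (¬? d) + 𝟙 d ≡ 1
  𝟙-¬ (yes _) = refl
  𝟙-¬ (no _)  = refl

  𝟙-idem : (d : Dec P) → 𝟙 d * 𝟙 d ≡ 𝟙 d
  𝟙-idem (yes _) = refl
  𝟙-idem (no _)  = refl

  ∑∈ : List A → (A → ℕ) → ℕ
  ∑∈ xs f = sum (map f xs)

  infix 7 ∑∈
  syntax ∑∈ xs (λ x → e) = ∑[ x ∈ xs ] e

  ∑∈-cong : (xs : List A) {f g : A → ℕ} → (∀ {x} → x ∈ xs → f x ≡ g x) → ∑∈ xs f ≡ ∑∈ xs g
  ∑∈-cong []       f≡g = refl
  ∑∈-cong (x ∷ xs) f≡g = cong₂ _+_ (f≡g (here refl)) (∑∈-cong xs (f≡g ∘ there))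

  ∑∈-mono : (xs : List A) {f g : A → ℕ} → (∀ {x} → x ∈ xs → f x ≤ g x) → ∑∈ xs f ≤ ∑∈ xs g
  ∑∈-mono []       f≤g = ℕ.z≤n
  ∑∈-mono (x ∷ xs) f≤g = ℕ.+-mono-≤ (f≤g (here refl)) (∑∈-mono xs (f≤g ∘ there))

  ∑∈-const : (xs : List A) (c : ℕ) → ∑[ x ∈ xs ] c ≡ length xs * c
  ∑∈-const []       c = refl
  ∑∈-const (x ∷ xs) c = cong (c +_) (∑∈-const xs c)

  ∑∈-zero : (xs : List A) → ∑[ x ∈ xs ] 0 ≡ 0
  ∑∈-zero xs = trans (∑∈-const xs 0) (ℕ.*-zeroʳ (length xs))

  ∑∈-+ : (xs : List A) (f g : A → ℕ) → ∑[ x ∈ xs ] (f x + g x) ≡ ∑∈ xs f + ∑∈ xs g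
  ∑∈-+ []       f g = refl
  ∑∈-+ (x ∷ xs) f g = trans (cong (f x + g x +_) (∑∈-+ xs f g))
    (solve 4 (λ a b c d → a :+ b :+ (c :+ d) := a :+ c :+ (b :+ d)) refl (f x) (g x) (∑∈ xs f) (∑∈ xs g))
    where open ℕ-Solver

  ∑∈-*ˡ : (xs : List A) (c : ℕ) (f : A → ℕ) → ∑[ x ∈ xs ] (c * f x) ≡ c * ∑∈ xs f
  ∑∈-*ˡ []       c f = sym (ℕ.*-zeroʳ c)
  ∑∈-*ˡ (x ∷ xs) c f = trans (cong (c * f x +_) (∑∈-*ˡ xs c f)) (sym (ℕ.*-distribˡ-+ c (f x) (∑∈ xs f)))

  ∑∈-*ʳ : (xs : List A) (c : ℕ) (f : A → ℕ) → ∑[ x ∈ xs ] (f x * c) ≡ ∑∈ xs f * c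
  ∑∈-*ʳ xs c f = trans (∑∈-cong xs (λ {x} _ → ℕ.*-comm (f x) c)) (trans (∑∈-*ˡ xs c f) (ℕ.*-comm c (∑∈ xs f)))

  ∑∈-++ : (xs ys : List A) (f : A → ℕ) → ∑∈ (xs ++ ys) f ≡ ∑∈ xs f + ∑∈ ys f
  ∑∈-++ []       ys f = refl
  ∑∈-++ (x ∷ xs) ys f = trans (cong (f x +_) (∑∈-++ xs ys f)) (sym (ℕ.+-assoc (f x) (∑∈ xs f) (∑∈ ys f)))

  ∑∈-map : (xs : List A) (h : A → B) (f : B → ℕ) → ∑∈ (map h xs) f ≡ ∑∈ xs (f ∘ h)
  ∑∈-map xs h f = cong sum (sym (List.map-∘ xs))

  ∑∈-swap : (xs : List A) (ys : List B) (f : A → B → ℕ) →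
    ∑[ x ∈ xs ] (∑[ y ∈ ys ] f x y) ≡ ∑[ y ∈ ys ] (∑[ x ∈ xs ] f x y)
  ∑∈-swap []       ys f = sym (∑∈-zero ys)
  ∑∈-swap (x ∷ xs) ys f = trans (cong (∑∈ ys (f x) +_) (∑∈-swap xs ys f)) (sym (∑∈-+ ys (f x) (λ y → ∑[ x ∈ xs ] f x y)))

  ∑∈-filter : {P : Pred A 0ℓ} (P? : Decidable P) (xs : List A) (f : A → ℕ) →
    ∑∈ (filter P? xs) f ≡ ∑[ x ∈ xs ] (𝟙 (P? x) * f x)
  ∑∈-filter P? []       f = refl
  ∑∈-filter P? (x ∷ xs) f with does (P? x)
  ... | true  = cong₂ _+_ (sym (ℕ.+-identityʳ (f x))) (∑∈-filter P? xs f)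
  ... | false = ∑∈-filter P? xs f

  length-∑∈ : (xs : List A) → length xs ≡ ∑[ x ∈ xs ] 1
  length-∑∈ xs = trans (sym (ℕ.*-identityʳ (length xs))) (sym (∑∈-const xs 1))

  length-filter-∑∈ : {P : Pred A 0ℓ} (P? : Decidable P) (xs : List A) → length (filter P? xs) ≡ ∑[ x ∈ xs ] 𝟙 (P? x)
  length-filter-∑∈ P? xs = trans (length-∑∈ (filter P? xs)) (trans (∑∈-filter P? xs (λ _ → 1)) (∑∈-cong xs (λ {x} _ → ℕ.*-identityʳ (𝟙 (P? x)))))

  ∑∈-cartesianProductWith : {C : Set} (h : A → B → C) (xs : List A) (ys : List B) (f : C → ℕ) →
    ∑∈ (cartesianProductWith h xs ys) f ≡ ∑[ x ∈ xs ] (∑[ y ∈ ys ] f (h x y))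
  ∑∈-cartesianProductWith h []       ys f = refl
  ∑∈-cartesianProductWith h (x ∷ xs) ys f = trans (∑∈-++ (map (h x) ys) (cartesianProductWith h xs ys) f)
    (cong₂ _+_ (∑∈-map ys (h x) f) (∑∈-cartesianProductWith h xs ys f))

  ∑∈-allFin : ∀ n (f : Fin (suc n) → ℕ) → ∑∈ (allFin (suc n)) f ≡ f zero + ∑∈ (allFin n) (f ∘ suc)
  ∑∈-allFin n f = cong (f zero +_) (trans (cong (λ xs → ∑∈ xs f) (sym (List.map-tabulate id suc))) (∑∈-map (allFin n) suc f))

  ∑∈-remove : ∀ {n} (v : Fin (suc n)) (f : Fin (suc n) → ℕ) →
    ∑∈ (allFin (suc n)) f ≡ f v + ∑[ w ∈ allFin n ] f (punchIn v w)
  ∑∈-remove {n} zero f = ∑∈-allFin n f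
  ∑∈-remove {suc n} (suc v) f = begin
    ∑∈ (allFin (2 + n)) f                          ≡⟨ ∑∈-allFin (suc n) f ⟩
    f zero + ∑∈ (allFin (suc n)) (f ∘ suc)         ≡⟨ cong (f zero +_) (∑∈-remove v (f ∘ suc)) ⟩
    f zero + (f (suc v) + r)                       ≡⟨ solve 3 (λ a b c → a :+ (b :+ c) := b :+ (a :+ c)) refl (f zero) (f (suc v)) r ⟩
    f (suc v) + (f zero + r)                       ≡⟨ cong (f (suc v) +_) (sym (∑∈-allFin n (f ∘ punchIn (suc v)))) ⟩
    f (suc v) + ∑∈ (allFin (suc n)) (f ∘ punchIn (suc v)) ∎
    where
    open ≡-Reasoning
    open ℕ-Solver
    r = ∑[ w ∈ allFin n ] f (suc (punchIn v w))

  length-allFin : ∀ n → length (allFin n) ≡ n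
  length-allFin n = List.length-tabulate {n = n} id

  -- Sums over tuples: independence of the coordinates

  ∑∈-tuples : ∀ n (xs : List A) (g : Vec A (suc n) → ℕ) →
    ∑∈ (tuples (suc n) xs) g ≡ ∑[ x ∈ xs ] (∑[ F ∈ tuples n xs ] g (x ∷ F))
  ∑∈-tuples n xs g = ∑∈-cartesianProductWith _∷_ xs (tuples n xs) g

  -- By independence any coordinate may be drawn first. Drawing the set of vertex v first turns
  -- isolation of v into a separate condition on each remaining coordinate.
  ∑∈-tuples-insertAt : ∀ {n} (v : Fin (suc n)) (xs : List A) (g : Vec A (suc n) → ℕ) →
    ∑∈ (tuples (suc n) xs) g ≡ ∑[ x ∈ xs ] (∑[ F ∈ tuples n xs ] g (insertAt F v x))
  ∑∈-tuples-insertAt {n = n} zero xs g = ∑∈-tuples n xs g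
  ∑∈-tuples-insertAt {n = suc n} (suc v) xs g = begin
    ∑∈ (tuples (2 + n) xs) g
      ≡⟨ ∑∈-tuples (suc n) xs g ⟩
    ∑[ y ∈ xs ] (∑[ F ∈ tuples (suc n) xs ] g (y ∷ F))
      ≡⟨ ∑∈-cong xs (λ {y} _ → ∑∈-tuples-insertAt v xs (λ F → g (y ∷ F))) ⟩
    ∑[ y ∈ xs ] (∑[ x ∈ xs ] (∑[ F ∈ tuples n xs ] g (y ∷ insertAt F v x)))
      ≡⟨ ∑∈-swap xs xs (λ y x → ∑[ F ∈ tuples n xs ] g (y ∷ insertAt F v x)) ⟩
    ∑[ x ∈ xs ] (∑[ y ∈ xs ] (∑[ F ∈ tuples n xs ] g (y ∷ insertAt F v x)))
      ≡⟨ ∑∈-cong xs (λ {x} _ → sym (∑∈-tuples n xs (λ F → g (insertAt F (suc v) x)))) ⟩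
    ∑[ x ∈ xs ] (∑[ F ∈ tuples (suc n) xs ] g (insertAt F (suc v) x)) ∎
    where open ≡-Reasoning

  length-tuples : ∀ n (xs : List A) → length (tuples n xs) ≡ length xs ^ n
  length-tuples zero    xs = refl
  length-tuples (suc n) xs = begin
    length (tuples (suc n) xs)                    ≡⟨ length-∑∈ (tuples (suc n) xs) ⟩
    ∑[ F ∈ tuples (suc n) xs ] 1                  ≡⟨ ∑∈-tuples n xs (λ _ → 1) ⟩
    ∑[ x ∈ xs ] (∑[ F ∈ tuples n xs ] 1)          ≡⟨ ∑∈-const xs _ ⟩
    length xs * (∑[ F ∈ tuples n xs ] 1)           ≡⟨ cong (length xs *_) (trans (sym (length-∑∈ (tuples n xs))) (length-tuples n xs)) ⟩
    length xs * length xs ^ n                     ∎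
    where open ≡-Reasoning

  -- Independence in counting form: a condition imposed on every coordinate separately multiplies.
  ∑∈-tuples-all : {P : Pred A 0ℓ} (P? : Decidable P) → ∀ n (xs : List A) →
    ∑[ F ∈ tuples n xs ] 𝟙 (Fin.all? (λ w → P? (lookup F w))) ≡ (∑[ x ∈ xs ] 𝟙 (P? x)) ^ n
  ∑∈-tuples-all P? zero    xs = refl
  ∑∈-tuples-all P? (suc n) xs = begin
    ∑[ F ∈ tuples (suc n) xs ] 𝟙 (all? F)
      ≡⟨ ∑∈-tuples n xs (𝟙 ∘ all?) ⟩
    ∑[ x ∈ xs ] (∑[ F ∈ tuples n xs ] 𝟙 (all? (x ∷ F)))
      ≡⟨ ∑∈-cong xs (λ {x} _ → trans (∑∈-cong (tuples n xs) (λ {F} _ → split x F)) (∑∈-*ˡ (tuples n xs) (𝟙 (P? x)) (𝟙 ∘ all?))) ⟩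
    ∑[ x ∈ xs ] (𝟙 (P? x) * (∑[ F ∈ tuples n xs ] 𝟙 (all? F)))
      ≡⟨ ∑∈-*ʳ xs (∑[ F ∈ tuples n xs ] 𝟙 (all? F)) (𝟙 ∘ P?) ⟩
    (∑[ x ∈ xs ] 𝟙 (P? x)) * (∑[ F ∈ tuples n xs ] 𝟙 (all? F))
      ≡⟨ cong ((∑[ x ∈ xs ] 𝟙 (P? x)) *_) (∑∈-tuples-all P? n xs) ⟩
    (∑[ x ∈ xs ] 𝟙 (P? x)) ^ suc n ∎
    where
    open ≡-Reasoning
    all? : ∀ {n} (F : Vec _ n) → Dec (∀ w → _)
    all? F = Fin.all? (λ w → P? (lookup F w))
    split : ∀ x F → 𝟙 (all? (x ∷ F)) ≡ 𝟙 (P? x) * 𝟙 (all? F)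
    split x F = trans
      (𝟙-cong (all? (x ∷ F)) (P? x ×-dec all? F)
        (λ p → p zero , p ∘ suc)
        (λ (p , q) → λ { zero → p ; (suc w) → q w }))
      (𝟙-× (P? x) (all? F))

  -- Counting the k-subsets disjoint from a given set

  Disjoint : ∀ {m} → Subset m → Subset m → Set
  Disjoint S z = ¬ Nonempty (S ∩ z)

  disjoint? : ∀ {m} (S z : Subset m) → Dec (Disjoint S z)
  disjoint? S z = ¬? (nonempty? (S ∩ z))

  disjoint-∷⁻ : ∀ a b {m} {S z : Subset m} → Disjoint (a ∷ S) (b ∷ z) → Disjoint S z
  disjoint-∷⁻ a b d (i , i∈) = d (suc i , Vec.there i∈)

  disjoint-outsideˡ : ∀ b {m} {S z : Subset m} → Disjoint S z → Disjoint (outside ∷ S) (b ∷ z)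
  disjoint-outsideˡ b d (suc i , Vec.there i∈) = d (i , i∈)

  disjoint-outsideʳ : ∀ b {m} {S z : Subset m} → Disjoint S z → Disjoint (b ∷ S) (outside ∷ z)
  disjoint-outsideʳ true  d (suc i , Vec.there i∈) = d (i , i∈)
  disjoint-outsideʳ false d (suc i , Vec.there i∈) = d (i , i∈)

  ∣∪∣-disjoint : ∀ {m} (S z : Subset m) → Disjoint S z → ∣ S ∪ z ∣ ≡ ∣ S ∣ + ∣ z ∣
  ∣∪∣-disjoint []            []            d = refl
  ∣∪∣-disjoint (inside ∷ S)  (inside ∷ z)  d = contradiction (zero , Vec.here) d
  ∣∪∣-disjoint (inside ∷ S)  (outside ∷ z) d = cong suc (∣∪∣-disjoint S z (disjoint-∷⁻ inside outside d))
  ∣∪∣-disjoint (outside ∷ S) (inside ∷ z)  d = trans (cong suc (∣∪∣-disjoint S z (disjoint-∷⁻ outside inside d))) (sym (ℕ.+-suc ∣ S ∣ ∣ z ∣))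
  ∣∪∣-disjoint (outside ∷ S) (outside ∷ z) d = ∣∪∣-disjoint S z (disjoint-∷⁻ outside outside d)

  private
    avoiding : ∀ {m} (S : Subset m) k (z : Subset m) → ℕ
    avoiding S k z = 𝟙 (∣ z ∣ ℕ.≟ k) * 𝟙 (disjoint? S z)

    -- Induction on the ground set. If the first point lies in S it must be left out, which keeps m
    -- - |S| unchanged; otherwise it may be taken or left, which is Pascal's rule.
    ∑-avoiding : ∀ {m} (S : Subset m) k → ∑∈ (subsets m) (avoiding S k) ≡ (m ∸ ∣ S ∣) C k
    ∑-avoiding [] zero    = refl
    ∑-avoiding [] (suc k) = sym (k>n⇒nCk≡0 {0} {suc k} ℕ.z<s)
    ∑-avoiding {suc m} (s ∷ S) k = begin
      ∑∈ (map (inside ∷_) zs ++ map (outside ∷_) zs) f           ≡⟨ ∑∈-++ (map (inside ∷_) zs) _ f ⟩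
      ∑∈ (map (inside ∷_) zs) f + ∑∈ (map (outside ∷_) zs) f     ≡⟨ cong₂ _+_ (∑∈-map zs (inside ∷_) f) (∑∈-map zs (outside ∷_) f) ⟩
      ∑∈ zs (f ∘ (inside ∷_)) + ∑∈ zs (f ∘ (outside ∷_))         ≡⟨ cong (∑∈ zs (f ∘ (inside ∷_)) +_) (trans (∑∈-cong zs (λ {z} _ → cong (𝟙 (∣ z ∣ ℕ.≟ k) *_) (𝟙-cong (disjoint? (s ∷ S) (outside ∷ z)) (disjoint? S z) (disjoint-∷⁻ s outside) (disjoint-outsideʳ s)))) (∑-avoiding S k)) ⟩
      ∑∈ zs (f ∘ (inside ∷_)) + (m ∸ ∣ S ∣) C k                  ≡⟨ with-first s k ⟩
      (suc m ∸ ∣ s ∷ S ∣) C k ∎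
      where
      open ≡-Reasoning
      zs = subsets m
      f = avoiding (s ∷ S) k
      with-first : ∀ s k → ∑[ z ∈ zs ] avoiding (s ∷ S) k (inside ∷ z) + (m ∸ ∣ S ∣) C k ≡ (suc m ∸ ∣ s ∷ S ∣) C k
      with-first inside k = cong (_+ (m ∸ ∣ S ∣) C k) (trans
        (∑∈-cong zs (λ {z} _ → trans (cong (𝟙 (suc ∣ z ∣ ℕ.≟ k) *_) (𝟙-false (disjoint? (inside ∷ S) (inside ∷ z)) (λ d → d (zero , Vec.here)))) (ℕ.*-zeroʳ (𝟙 (suc ∣ z ∣ ℕ.≟ k)))))
        (∑∈-zero zs))
      with-first outside zero = cong (_+ 1) (∑∈-zero zs)
      with-first outside (suc k) = begin
        ∑[ z ∈ zs ] avoiding (outside ∷ S) (suc k) (inside ∷ z) + (m ∸ ∣ S ∣) C suc k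
          ≡⟨ cong (_+ (m ∸ ∣ S ∣) C suc k) (trans (∑∈-cong zs (λ {z} _ → cong (𝟙 (∣ z ∣ ℕ.≟ k) *_) (𝟙-cong (disjoint? (outside ∷ S) (inside ∷ z)) (disjoint? S z) (disjoint-∷⁻ outside inside) (disjoint-outsideˡ inside)))) (∑-avoiding S k)) ⟩
        (m ∸ ∣ S ∣) C k + (m ∸ ∣ S ∣) C suc k      ≡⟨ nCk+nC[k+1]≡[n+1]C[k+1] (m ∸ ∣ S ∣) k ⟩
        -- Since |S| ≤ m, truncated subtraction commutes with the successor.
        suc (m ∸ ∣ S ∣) C suc k                    ≡⟨ cong (_C suc k) (sym (ℕ.+-∸-assoc 1 (∣p∣≤n S))) ⟩
        (suc m ∸ ∣ S ∣) C suc k                    ∎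

  count-disjoint : ∀ {m} (S : Subset m) k → ∑[ z ∈ kSubsets m k ] 𝟙 (disjoint? S z) ≡ (m ∸ ∣ S ∣) C k
  count-disjoint {m} S k = trans (∑∈-filter (λ z → ∣ z ∣ ℕ.≟ k) (subsets m) (λ z → 𝟙 (disjoint? S z))) (∑-avoiding S k)

  ∣kSubset∣ : ∀ {m k z} → z ∈ kSubsets m k → ∣ z ∣ ≡ k
  ∣kSubset∣ {m} {k} z∈ = proj₂ (∈-filter⁻ (λ z → ∣ z ∣ ℕ.≟ k) {xs = subsets m} z∈)

  -- The case `S = ⊥` of `count-disjoint`, as every set is disjoint from the empty one.
  length-kSubsets : ∀ m k → length (kSubsets m k) ≡ m C k
  length-kSubsets m k = begin
    length (kSubsets m k)                               ≡⟨ length-∑∈ (kSubsets m k) ⟩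
    ∑[ z ∈ kSubsets m k ] 1                             ≡⟨ ∑∈-cong (kSubsets m k) (λ {z} _ → sym (𝟙-true (disjoint? ⊥ z) (λ (i , i∈) → ∉⊥ (proj₁ (x∈p∩q⁻ ⊥ z i∈))))) ⟩
    ∑[ z ∈ kSubsets m k ] 𝟙 (disjoint? ⊥ z)             ≡⟨ count-disjoint {m} ⊥ k ⟩
    (m ∸ ∣ ⊥ {m} ∣) C k                                 ≡⟨ cong (λ s → (m ∸ s) C k) (∣⊥∣≡0 m) ⟩
    m C k                                               ∎
    where open ≡-Reasoning

  length-assignments : ∀ n m k → length (assignments n m k) ≡ (m C k) ^ n
  length-assignments n m k = trans (length-tuples n (kSubsets m k)) (cong (_^ n) (length-kSubsets m k))

  -- Moments of the number of isolated vertices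

  isolated? : ∀ {n m} (F : Vec (Subset m) n) (v : Fin n) → Dec (Isolated (intersectionGraph F) v)
  isolated? F v = Fin.all? (λ u → ¬? (adj? (intersectionGraph F) v u))

  isolated-number : ∀ {n m} → Vec (Subset m) n → ℕ
  isolated-number {n} F = ∑[ v ∈ allFin n ] 𝟙 (isolated? F v)

  isolated-insertAt⁻ : ∀ {n m} (F : Vec (Subset m) n) v x → Isolated (intersectionGraph (insertAt F v x)) v →
    ∀ w → Disjoint x (lookup F w)
  isolated-insertAt⁻ F v x iso w ne = iso (punchIn v w)
    (Fin.punchInᵢ≢i v w ∘ sym , subst₂ (λ a b → Nonempty (a ∩ b)) (sym (insertAt-lookup F v x)) (sym (insertAt-punchIn F v x w)) ne)

  isolated-insertAt⁺ : ∀ {n m} (F : Vec (Subset m) n) v x → (∀ w → Disjoint x (lookup F w)) →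
    Isolated (intersectionGraph (insertAt F v x)) v
  isolated-insertAt⁺ F v x disj u (v≢u , ne) = disj (punchOut v≢u)
    (subst₂ (λ a b → Nonempty (a ∩ b)) (insertAt-lookup F v x)
      (trans (cong (lookup (insertAt F v x)) (sym (Fin.punchIn-punchOut v≢u))) (insertAt-punchIn F v x (punchOut v≢u))) ne)

  module _ (m k : ℕ) where
    private
      Ks : List (Subset m)
      Ks = kSubsets m k

      α β : ℕ
      α = (m ∸ k) C k
      β = (m ∸ (k + k)) C k

      T : ℕ
      T = m C k

    count-disjoint-k : ∀ {x} → x ∈ Ks → ∑[ z ∈ Ks ] 𝟙 (disjoint? x z) ≡ α
    count-disjoint-k {x} x∈ = trans (count-disjoint x k) (cong (λ s → (m ∸ s) C k) (∣kSubset∣ x∈))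

    -- Given the set x of v, the other n vertices avoid x independently, each in α ways whatever x
    -- is.
    count-isolated : ∀ n (v : Fin (suc n)) → ∑[ F ∈ assignments (suc n) m k ] 𝟙 (isolated? F v) ≡ T * α ^ n
    count-isolated n v = begin
      ∑[ F ∈ tuples (suc n) Ks ] 𝟙 (isolated? F v)
        ≡⟨ ∑∈-tuples-insertAt v Ks (λ F → 𝟙 (isolated? F v)) ⟩
      ∑[ x ∈ Ks ] (∑[ F ∈ tuples n Ks ] 𝟙 (isolated? (insertAt F v x) v))
        ≡⟨ ∑∈-cong Ks (λ {x} x∈ → per-x x∈) ⟩
      ∑[ x ∈ Ks ] (α ^ n)
        ≡⟨ trans (∑∈-const Ks (α ^ n)) (cong (_* α ^ n) (length-kSubsets m k)) ⟩
      T * α ^ n ∎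
      where
      open ≡-Reasoning
      per-x : ∀ {x} → x ∈ Ks → ∑[ F ∈ tuples n Ks ] 𝟙 (isolated? (insertAt F v x) v) ≡ α ^ n
      per-x {x} x∈ = begin
        ∑[ F ∈ tuples n Ks ] 𝟙 (isolated? (insertAt F v x) v)
          ≡⟨ ∑∈-cong (tuples n Ks) (λ {F} _ → 𝟙-cong (isolated? (insertAt F v x) v) (Fin.all? (λ w → disjoint? x (lookup F w))) (isolated-insertAt⁻ F v x) (isolated-insertAt⁺ F v x)) ⟩
        ∑[ F ∈ tuples n Ks ] 𝟙 (Fin.all? (λ w → disjoint? x (lookup F w)))
          ≡⟨ ∑∈-tuples-all (disjoint? x) n Ks ⟩
        (∑[ z ∈ Ks ] 𝟙 (disjoint? x z)) ^ n
          ≡⟨ cong (_^ n) (count-disjoint-k x∈) ⟩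
        α ^ n ∎

    count-disjoint-both : ∀ {x y} → x ∈ Ks → y ∈ Ks → Disjoint x y →
      ∑[ z ∈ Ks ] 𝟙 (disjoint? x z ×-dec disjoint? y z) ≡ β
    count-disjoint-both {x} {y} x∈ y∈ d = begin
      ∑[ z ∈ Ks ] 𝟙 (disjoint? x z ×-dec disjoint? y z)
        ≡⟨ ∑∈-cong Ks (λ {z} _ → 𝟙-cong (disjoint? x z ×-dec disjoint? y z) (disjoint? (x ∪ y) z) (to z) (from z)) ⟩
      ∑[ z ∈ Ks ] 𝟙 (disjoint? (x ∪ y) z)
        ≡⟨ count-disjoint (x ∪ y) k ⟩
      (m ∸ ∣ x ∪ y ∣) C k
        ≡⟨ cong (λ s → (m ∸ s) C k) (trans (∣∪∣-disjoint x y d) (cong₂ _+_ (∣kSubset∣ x∈) (∣kSubset∣ y∈))) ⟩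
      β ∎
      where
      open ≡-Reasoning
      to : ∀ z → Disjoint x z × Disjoint y z → Disjoint (x ∪ y) z
      to z (dx , dy) (i , i∈) with x∈p∩q⁻ (x ∪ y) z i∈
      ... | i∈∪ , i∈z with x∈p∪q⁻ x y i∈∪
      ... | inj₁ i∈x = dx (i , x∈p∩q⁺ (i∈x , i∈z))
      ... | inj₂ i∈y = dy (i , x∈p∩q⁺ (i∈y , i∈z))
      from : ∀ z → Disjoint (x ∪ y) z → Disjoint x z × Disjoint y z
      from z d = (λ (i , i∈) → let (a , b) = x∈p∩q⁻ x z i∈ in d (i , x∈p∩q⁺ (x∈p∪q⁺ (inj₁ a) , b)))
               , (λ (i , i∈) → let (a , b) = x∈p∩q⁻ y z i∈ in d (i , x∈p∩q⁺ (x∈p∪q⁺ (inj₂ a) , b)))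

    -- Given the sets x and y of the two vertices, joint isolation forces x and y to be disjoint,
    -- since the vertices are not adjacent, and every other set to avoid both. There are Tα disjoint
    -- pairs, and each other vertex has β choices.
    count-isolated-pair : ∀ n (v : Fin (2 + n)) (w : Fin (1 + n)) →
      ∑[ F ∈ assignments (2 + n) m k ] (𝟙 (isolated? F v) * 𝟙 (isolated? F (punchIn v w))) ≤ T * (α * β ^ n)
    count-isolated-pair n v w = begin
      ∑[ F ∈ tuples (2 + n) Ks ] both F
        ≡⟨ ∑∈-tuples-insertAt v Ks both ⟩
      ∑[ x ∈ Ks ] (∑[ F ∈ tuples (1 + n) Ks ] both (insertAt F v x))
        ≡⟨ ∑∈-cong Ks (λ {x} _ → ∑∈-tuples-insertAt w Ks (λ F → both (insertAt F v x))) ⟩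
      ∑[ x ∈ Ks ] (∑[ y ∈ Ks ] (∑[ F ∈ tuples n Ks ] both (insertAt (insertAt F w y) v x)))
        ≤⟨ ∑∈-mono Ks (λ x∈ → ∑∈-mono Ks (λ y∈ → per-xy x∈ y∈)) ⟩
      ∑[ x ∈ Ks ] (∑[ y ∈ Ks ] (𝟙 (disjoint? x y) * β ^ n))
        ≡⟨ ∑∈-cong Ks (λ {x} x∈ → trans (∑∈-*ʳ Ks (β ^ n) (λ y → 𝟙 (disjoint? x y))) (cong (_* β ^ n) (count-disjoint-k x∈))) ⟩
      ∑[ x ∈ Ks ] (α * β ^ n)
        ≡⟨ trans (∑∈-const Ks (α * β ^ n)) (cong (_* (α * β ^ n)) (length-kSubsets m k)) ⟩
      T * (α * β ^ n) ∎
      where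
      open ℕ.≤-Reasoning
      both : Vec (Subset m) (2 + n) → ℕ
      both F = 𝟙 (isolated? F v) * 𝟙 (isolated? F (punchIn v w))
      per-xy : ∀ {x y} → x ∈ Ks → y ∈ Ks →
        ∑[ F ∈ tuples n Ks ] both (insertAt (insertAt F w y) v x) ≤ 𝟙 (disjoint? x y) * β ^ n
      per-xy {x} {y} x∈ y∈ = begin
        ∑[ F ∈ tuples n Ks ] both (insertAt (insertAt F w y) v x)
          ≤⟨ ∑∈-mono (tuples n Ks) (λ {F} _ → bound F) ⟩
        ∑[ F ∈ tuples n Ks ] (𝟙 (disjoint? x y) * 𝟙 (all? F))
          ≡⟨ ∑∈-*ˡ (tuples n Ks) (𝟙 (disjoint? x y)) (𝟙 ∘ all?) ⟩
        𝟙 (disjoint? x y) * (∑[ F ∈ tuples n Ks ] 𝟙 (all? F))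
          ≡⟨ cong (𝟙 (disjoint? x y) *_) (∑∈-tuples-all (λ z → disjoint? x z ×-dec disjoint? y z) n Ks) ⟩
        𝟙 (disjoint? x y) * (∑[ z ∈ Ks ] 𝟙 (disjoint? x z ×-dec disjoint? y z)) ^ n
          ≡⟨ collapse (disjoint? x y) ⟩
        𝟙 (disjoint? x y) * β ^ n ∎
        where
        all? : (F : Vec (Subset m) n) → Dec (∀ j → Disjoint x (lookup F j) × Disjoint y (lookup F j))
        all? F = Fin.all? (λ j → disjoint? x (lookup F j) ×-dec disjoint? y (lookup F j))
        -- β counts the sets avoiding x and y only when these are disjoint; otherwise the indicator
        -- makes both sides zero.
        collapse : (d : Dec (Disjoint x y)) → 𝟙 d * (∑[ z ∈ Ks ] 𝟙 (disjoint? x z ×-dec disjoint? y z)) ^ n ≡ 𝟙 d * β ^ n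
        collapse (yes d) = cong (λ s → 1 * s ^ n) (count-disjoint-both x∈ y∈ d)
        collapse (no _)  = refl
        bound : ∀ F → both (insertAt (insertAt F w y) v x) ≤ 𝟙 (disjoint? x y) * 𝟙 (all? F)
        bound F = subst₂ _≤_ (𝟙-× (isolated? F″ v) (isolated? F″ (punchIn v w))) (𝟙-× (disjoint? x y) (all? F))
          (𝟙-mono (isolated? F″ v ×-dec isolated? F″ (punchIn v w)) (disjoint? x y ×-dec all? F)
            (λ (iso-v , iso-w) → let disj-v = isolated-insertAt⁻ F′ v x iso-v in
              subst (Disjoint x) (insertAt-lookup F w y) (disj-v w) ,
              λ j → subst (Disjoint x) (insertAt-punchIn F w y j) (disj-v (punchIn w j)) , disj-w iso-w j))
          where
          F′ = insertAt F w y
          F″ = insertAt F′ v x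
          disj-w : Isolated (intersectionGraph F″) (punchIn v w) → ∀ j → Disjoint y (lookup F j)
          disj-w iso j ne = iso (punchIn v (punchIn w j))
            ( (λ eq → Fin.punchInᵢ≢i w j (sym (Fin.punchIn-injective v w (punchIn w j) eq)))
            , subst₂ (λ a b → Nonempty (a ∩ b))
                (sym (trans (insertAt-punchIn F′ v x w) (insertAt-lookup F w y)))
                (sym (trans (insertAt-punchIn F′ v x (punchIn w j)) (insertAt-punchIn F w y j))) ne)

    first-moment : ∀ n → ∑[ F ∈ assignments (suc n) m k ] isolated-number F ≡ suc n * (T * α ^ n)
    first-moment n = begin
      ∑[ F ∈ assignments (suc n) m k ] (∑[ v ∈ allFin (suc n) ] 𝟙 (isolated? F v))
        ≡⟨ ∑∈-swap (assignments (suc n) m k) (allFin (suc n)) (λ F v → 𝟙 (isolated? F v)) ⟩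
      ∑[ v ∈ allFin (suc n) ] (∑[ F ∈ assignments (suc n) m k ] 𝟙 (isolated? F v))
        ≡⟨ ∑∈-cong (allFin (suc n)) (λ {v} _ → count-isolated n v) ⟩
      ∑[ v ∈ allFin (suc n) ] (T * α ^ n)
        ≡⟨ trans (∑∈-const (allFin (suc n)) (T * α ^ n)) (cong (_* (T * α ^ n)) (length-allFin (suc n))) ⟩
      suc n * (T * α ^ n) ∎
      where open ≡-Reasoning

    -- In X² = ∑ over pairs (v, u), the diagonal contributes the first moment because indicators are
    -- idempotent; the off-diagonal pairs are indexed by `punchIn v w`.
    second-moment : ∀ n → ∑[ F ∈ assignments (2 + n) m k ] (isolated-number F * isolated-number F) ≤
      (2 + n) * (T * α ^ (1 + n)) + (2 + n) * ((1 + n) * (T * (α * β ^ n)))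
    second-moment n = begin
      ∑[ F ∈ Ω ] (isolated-number F * isolated-number F)
        ≡⟨ ∑∈-cong Ω (λ {F} _ → sym (∑∈-*ʳ V (isolated-number F) (λ v → 𝟙 (isolated? F v)))) ⟩
      ∑[ F ∈ Ω ] (∑[ v ∈ V ] (𝟙 (isolated? F v) * isolated-number F))
        ≡⟨ ∑∈-swap Ω V (λ F v → 𝟙 (isolated? F v) * isolated-number F) ⟩
      ∑[ v ∈ V ] (∑[ F ∈ Ω ] (𝟙 (isolated? F v) * isolated-number F))
        ≤⟨ ∑∈-mono V (λ {v} _ → per-v v) ⟩
      ∑[ v ∈ V ] (T * α ^ (1 + n) + (1 + n) * (T * (α * β ^ n)))
        ≡⟨ trans (∑∈-const V (T * α ^ (1 + n) + (1 + n) * (T * (α * β ^ n)))) (cong (_* (T * α ^ (1 + n) + (1 + n) * (T * (α * β ^ n)))) (length-allFin (2 + n))) ⟩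
      (2 + n) * (T * α ^ (1 + n) + (1 + n) * (T * (α * β ^ n)))
        ≡⟨ ℕ.*-distribˡ-+ (2 + n) (T * α ^ (1 + n)) ((1 + n) * (T * (α * β ^ n))) ⟩
      (2 + n) * (T * α ^ (1 + n)) + (2 + n) * ((1 + n) * (T * (α * β ^ n))) ∎
      where
      open ℕ.≤-Reasoning
      Ω = assignments (2 + n) m k
      V = allFin (2 + n)
      W = allFin (1 + n)
      per-F : ∀ v F → 𝟙 (isolated? F v) * isolated-number F
        ≡ 𝟙 (isolated? F v) + ∑[ w ∈ W ] (𝟙 (isolated? F v) * 𝟙 (isolated? F (punchIn v w)))
      per-F v F = begin-equality
        a * isolated-number F                                           ≡⟨ cong (a *_) (∑∈-remove v (λ u → 𝟙 (isolated? F u))) ⟩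
        a * (a + (∑[ w ∈ W ] 𝟙 (isolated? F (punchIn v w))))            ≡⟨ ℕ.*-distribˡ-+ a a _ ⟩
        a * a + a * (∑[ w ∈ W ] 𝟙 (isolated? F (punchIn v w)))          ≡⟨ cong₂ _+_ (𝟙-idem (isolated? F v)) (sym (∑∈-*ˡ W a (λ w → 𝟙 (isolated? F (punchIn v w))))) ⟩
        a + ∑[ w ∈ W ] (a * 𝟙 (isolated? F (punchIn v w)))              ∎
        where a = 𝟙 (isolated? F v)
      per-v : ∀ v → ∑[ F ∈ Ω ] (𝟙 (isolated? F v) * isolated-number F) ≤ T * α ^ (1 + n) + (1 + n) * (T * (α * β ^ n))
      per-v v = begin
        ∑[ F ∈ Ω ] (𝟙 (isolated? F v) * isolated-number F)
          ≡⟨ ∑∈-cong Ω (λ {F} _ → per-F v F) ⟩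
        ∑[ F ∈ Ω ] (𝟙 (isolated? F v) + ∑[ w ∈ W ] pair F w)
          ≡⟨ ∑∈-+ Ω (λ F → 𝟙 (isolated? F v)) (λ F → ∑[ w ∈ W ] pair F w) ⟩
        (∑[ F ∈ Ω ] 𝟙 (isolated? F v)) + (∑[ F ∈ Ω ] (∑[ w ∈ W ] pair F w))
          ≡⟨ cong₂ _+_ (count-isolated (1 + n) v) (∑∈-swap Ω W pair) ⟩
        T * α ^ (1 + n) + (∑[ w ∈ W ] (∑[ F ∈ Ω ] pair F w))
          ≤⟨ ℕ.+-monoʳ-≤ (T * α ^ (1 + n)) (∑∈-mono W (λ {w} _ → count-isolated-pair n v w)) ⟩
        T * α ^ (1 + n) + (∑[ w ∈ W ] (T * (α * β ^ n)))
          ≡⟨ cong (T * α ^ (1 + n) +_) (trans (∑∈-const W (T * (α * β ^ n))) (cong (_* (T * (α * β ^ n))) (length-allFin (1 + n)))) ⟩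
        T * α ^ (1 + n) + (1 + n) * (T * (α * β ^ n)) ∎
        where
        pair : Vec (Subset m) (2 + n) → Fin (1 + n) → ℕ
        pair F w = 𝟙 (isolated? F v) * 𝟙 (isolated? F (punchIn v w))

  -- The bounds of Chebyshev and Markov in counting form

  2ab≤a²+b² : ∀ a b → 2 * (a * b) ≤ a * a + b * b
  2ab≤a²+b² a b with ℕ.≤-total a b
  ... | inj₁ a≤b = subst (λ b → 2 * (a * b) ≤ a * a + b * b) (ℕ.m+[n∸m]≡n a≤b)
    (subst (2 * (a * (a + c)) ≤_)
      (solve 2 (λ a c → con 2 :* (a :* (a :+ c)) :+ c :* c := a :* a :+ (a :+ c) :* (a :+ c)) refl a c)
      (ℕ.m≤m+n (2 * (a * (a + c))) (c * c)))
    where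
    open ℕ-Solver
    c = b ∸ a
  ... | inj₂ b≤a = subst (λ a → 2 * (a * b) ≤ a * a + b * b) (ℕ.m+[n∸m]≡n b≤a)
    (subst (2 * ((b + c) * b) ≤_)
      (solve 2 (λ b c → con 2 :* ((b :+ c) :* b) :+ c :* c := (b :+ c) :* (b :+ c) :+ b :* b) refl b c)
      (ℕ.m≤m+n (2 * ((b + c) * b)) (c * c)))
    where
    open ℕ-Solver
    c = a ∸ b

  -- Chebyshev's inequality P(X = 0) ≤ Var X / (E X)², multiplied out.
  chebyshev : (Ω : List A) (X : A → ℕ) {E : Pred A 0ℓ} (E? : Decidable E) → (∀ x → E x → X x ≡ 0) →
    let N = length Ω; N₀ = ∑[ x ∈ Ω ] 𝟙 (E? x); S₁ = ∑∈ Ω X; S₂ = ∑[ x ∈ Ω ] (X x * X x) in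
    N₀ * (S₁ * S₁) + N * (S₁ * S₁) ≤ N * N * S₂
  chebyshev Ω X E? X≡0 = ℕ.+-cancelʳ-≤ (N * (S₁ * S₁)) _ _ (begin
    N₀ * (S₁ * S₁) + N * (S₁ * S₁) + N * (S₁ * S₁)
      ≡⟨ solve 3 (λ p n s → p :* (s :* s) :+ n :* (s :* s) :+ n :* (s :* s) := p :* (s :* s) :+ con 2 :* (n :* s) :* s) refl N₀ N S₁ ⟩
    N₀ * (S₁ * S₁) + 2 * (N * S₁) * S₁
      ≡⟨ cong₂ _+_ (∑∈-*ʳ Ω (S₁ * S₁) (λ x → 𝟙 (E? x))) (∑∈-*ˡ Ω (2 * (N * S₁)) X) ⟨
    ∑[ x ∈ Ω ] (𝟙 (E? x) * (S₁ * S₁)) + ∑[ x ∈ Ω ] (2 * (N * S₁) * X x)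
      ≡⟨ ∑∈-+ Ω (λ x → 𝟙 (E? x) * (S₁ * S₁)) (λ x → 2 * (N * S₁) * X x) ⟨
    ∑[ x ∈ Ω ] (𝟙 (E? x) * (S₁ * S₁) + 2 * (N * S₁) * X x)
      ≤⟨ ∑∈-mono Ω (λ {x} _ → pointwise x (E? x)) ⟩
    ∑[ x ∈ Ω ] (N * N * (X x * X x) + S₁ * S₁)
      ≡⟨ ∑∈-+ Ω (λ x → N * N * (X x * X x)) (λ _ → S₁ * S₁) ⟩
    ∑[ x ∈ Ω ] (N * N * (X x * X x)) + ∑[ x ∈ Ω ] (S₁ * S₁)
      ≡⟨ cong₂ _+_ (∑∈-*ˡ Ω (N * N) (λ x → X x * X x)) (∑∈-const Ω (S₁ * S₁)) ⟩
    N * N * S₂ + N * (S₁ * S₁) ∎)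
    where
    open ℕ.≤-Reasoning
    open ℕ-Solver
    N = length Ω
    N₀ = ∑[ x ∈ Ω ] 𝟙 (E? x)
    S₁ = ∑∈ Ω X
    S₂ = ∑[ x ∈ Ω ] (X x * X x)
    -- This is (N X - S₁)² ≥ S₁² on E, where X = 0, and (N X - S₁)² ≥ 0 elsewhere. The cross term
    -- stands on the left because subtraction in ℕ is truncated.
    pointwise : ∀ x (d : Dec _) → 𝟙 d * (S₁ * S₁) + 2 * (N * S₁) * X x ≤ N * N * (X x * X x) + S₁ * S₁
    pointwise x (yes e) = ℕ.≤-reflexive (subst (λ t → 1 * (S₁ * S₁) + 2 * (N * S₁) * t ≡ N * N * (t * t) + S₁ * S₁) (sym (X≡0 x e))
      (solve 2 (λ n s → con 1 :* (s :* s) :+ con 2 :* (n :* s) :* con 0 := n :* n :* (con 0 :* con 0) :+ s :* s) refl N S₁))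
    pointwise x (no _) = subst₂ _≤_
      (solve 3 (λ n t s → con 2 :* (n :* t :* s) := con 2 :* (n :* s) :* t) refl N (X x) S₁)
      (solve 3 (λ n t s → n :* t :* (n :* t) :+ s :* s := n :* n :* (t :* t) :+ s :* s) refl N (X x) S₁)
      (2ab≤a²+b² (N * X x) S₁)

  length-filter-¬ : {E : Pred A 0ℓ} (E? : Decidable E) (Ω : List A) →
    length (filter (λ x → ¬? (E? x)) Ω) + length (filter E? Ω) ≡ length Ω
  length-filter-¬ E? Ω = begin
    length (filter (λ x → ¬? (E? x)) Ω) + length (filter E? Ω)   ≡⟨ cong₂ _+_ (length-filter-∑∈ (λ x → ¬? (E? x)) Ω) (length-filter-∑∈ E? Ω) ⟩
    ∑[ x ∈ Ω ] 𝟙 (¬? (E? x)) + ∑[ x ∈ Ω ] 𝟙 (E? x)               ≡⟨ ∑∈-+ Ω (λ x → 𝟙 (¬? (E? x))) (λ x → 𝟙 (E? x)) ⟨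
    ∑[ x ∈ Ω ] (𝟙 (¬? (E? x)) + 𝟙 (E? x))                        ≡⟨ ∑∈-cong Ω (λ {x} _ → 𝟙-¬ (E? x)) ⟩
    ∑[ x ∈ Ω ] 1                                                 ≡⟨ length-∑∈ Ω ⟨
    length Ω                                                     ∎
    where open ≡-Reasoning

  f≤∑∈-allFin : ∀ {n} (v : Fin n) (f : Fin n → ℕ) → f v ≤ ∑∈ (allFin n) f
  f≤∑∈-allFin {suc n} v f = subst (f v ≤_) (sym (∑∈-remove v f)) (ℕ.m≤m+n (f v) _)

  hasIsolated? : ∀ {n m} (F : Vec (Subset m) n) → Dec (HasIsolatedVertex (intersectionGraph F))
  hasIsolated? F = hasIsolatedVertex? (intersectionGraph F)

  hasIsolated≤number : ∀ {n m} (F : Vec (Subset m) n) → 𝟙 (hasIsolated? F) ≤ isolated-number F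
  hasIsolated≤number F with hasIsolated? F
  ... | no _ = ℕ.z≤n
  ... | yes (v , iso) = subst (_≤ isolated-number F) (𝟙-true (isolated? F v) iso) (f≤∑∈-allFin v (λ u → 𝟙 (isolated? F u)))

  noIsolated⇒number≡0 : ∀ {n m} (F : Vec (Subset m) n) → NoIsolatedVertex (intersectionGraph F) → isolated-number F ≡ 0
  noIsolated⇒number≡0 {n} F none = trans (∑∈-cong (allFin n) (λ {v} _ → 𝟙-false (isolated? F v) (λ iso → none (v , iso)))) (∑∈-zero (allFin n))

  -- Markov's inequality: the indicator of X > 0 is at most X.
  #hasIsolated≤ : ∀ m k j → length (filter hasIsolated? (assignments (suc j) m k)) ≤ suc j * ((m C k) * ((m ∸ k) C k) ^ j)
  #hasIsolated≤ m k j = begin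
    length (filter hasIsolated? Ω)               ≡⟨ length-filter-∑∈ hasIsolated? Ω ⟩
    ∑[ F ∈ Ω ] 𝟙 (hasIsolated? F)                ≤⟨ ∑∈-mono Ω (λ {F} _ → hasIsolated≤number F) ⟩
    ∑[ F ∈ Ω ] isolated-number F             ≡⟨ first-moment m k j ⟩
    suc j * ((m C k) * ((m ∸ k) C k) ^ j)        ∎
    where
    open ℕ.≤-Reasoning
    Ω = assignments (suc j) m k

  ^-distrib-* : ∀ a b i → (a * b) ^ i ≡ a ^ i * b ^ i
  ^-distrib-* a b zero    = refl
  ^-distrib-* a b (suc i) = trans (cong (a * b *_) (^-distrib-* a b i))
    (solve 4 (λ a b c d → a :* b :* (c :* d) := a :* c :* (b :* d)) refl a b (a ^ i) (b ^ i))
    where open ℕ-Solver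

  -- Divided by N n αʲ, the conclusion reads P(X = 0) + 1 ≤ 1/E X + T/α. It is Chebyshev's
  -- inequality with the second moment inserted and the common factor `S₁ * T` cancelled.
  moment-quotient : ∀ i {N₀ T α β S₂} .{{_ : NonZero T}} .{{_ : NonZero α}} →
    let j = suc i; n = suc j; N = T ^ n; S₁ = n * (T * α ^ j) in
    β * T ≤ α * α → S₂ ≤ S₁ + n * (j * (T * (α * β ^ i))) →
    N₀ * (S₁ * S₁) + N * (S₁ * S₁) ≤ N * N * S₂ →
    N₀ * (n * α ^ j) + N * (n * α ^ j) ≤ N * T ^ j + N * (n * (T * α ^ i))
  moment-quotient i {N₀} {T} {α} {β} {S₂} βT≤α² S₂≤ cheb = ℕ.*-cancelʳ-≤ _ _ (S₁ * T) (begin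
    (N₀ * (n * (α * a)) + N * (n * (α * a))) * (S₁ * T)
      ≡⟨ solve 6 (λ N₀ N n α a T → let s = n :* (T :* (α :* a)) in
           (N₀ :* (n :* (α :* a)) :+ N :* (n :* (α :* a))) :* (s :* T) := N₀ :* (s :* s) :+ N :* (s :* s)) refl N₀ N n α a T ⟩
    N₀ * (S₁ * S₁) + N * (S₁ * S₁)
      ≤⟨ cheb ⟩
    N * N * S₂
      ≤⟨ ℕ.*-monoʳ-≤ (N * N) S₂≤ ⟩
    N * N * (S₁ + n * (j * (T * (α * b))))
      ≡⟨ solve 7 (λ N S n j t α b → N :* N :* (S :+ n :* (j :* (t :* (α :* b)))) := N :* N :* S :+ N :* n :* (N :* (j :* (t :* (α :* b))))) refl N S₁ n j T α b ⟩
    N * N * S₁ + N * n * (N * (j * (T * (α * b))))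
      ≡⟨ cong (N * N * S₁ +_) (cong (N * n *_) (solve 5 (λ T τ j α b → T :* (T :* τ) :* (j :* (T :* (α :* b))) := j :* (T :* (T :* (T :* α)) :* (b :* τ))) refl T τ j α b)) ⟩
    N * N * S₁ + N * n * (j * (T * (T * (T * α)) * (b * τ)))
      -- Rounding j up to n and (βT)ⁱ up to α²ⁱ makes the pair term divisible by `S₁ * T`.
      ≤⟨ ℕ.+-monoʳ-≤ (N * N * S₁) (ℕ.*-monoʳ-≤ (N * n) (ℕ.*-mono-≤ (ℕ.n≤1+n j) (ℕ.*-monoʳ-≤ (T * (T * (T * α))) bτ≤aa))) ⟩
    N * N * S₁ + N * n * (n * (T * (T * (T * α)) * (a * a)))
      ≡⟨ solve 6 (λ T τ n α a N → let S = n :* (T :* (α :* a)) in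
           N :* (T :* (T :* τ)) :* S :+ N :* n :* (n :* (T :* (T :* (T :* α)) :* (a :* a))) :=
           (N :* (T :* τ) :+ N :* (n :* (T :* a))) :* (S :* T)) refl T τ n α a N ⟩
    (N * (T * τ) + N * (n * (T * a))) * (S₁ * T) ∎)
    where
    open ℕ.≤-Reasoning
    open ℕ-Solver
    j = suc i
    n = suc j
    N = T ^ n
    a = α ^ i
    b = β ^ i
    τ = T ^ i
    S₁ = n * (T * (α * a))
    instance
      αʲ≢0 : NonZero (α * a)
      αʲ≢0 = ℕ.m^n≢0 α j
      Tαʲ≢0 : NonZero (T * (α * a))
      Tαʲ≢0 = ℕ.m*n≢0 T (α * a)
      S₁≢0 : NonZero S₁
      S₁≢0 = ℕ.m*n≢0 n (T * (α * a))
      S₁T≢0 : NonZero (S₁ * T)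
      S₁T≢0 = ℕ.m*n≢0 S₁ T
    bτ≤aa : b * τ ≤ a * a
    bτ≤aa = subst₂ _≤_ (^-distrib-* β T i) (^-distrib-* α α i) (ℕ.^-monoˡ-≤ i βT≤α²)

  C-log-concave-∸ : ∀ {m k} → k + k ≤ m → ((m ∸ (k + k)) C k) * (m C k) ≤ ((m ∸ k) C k) * ((m ∸ k) C k)
  C-log-concave-∸ {m} {k} 2k≤m = subst₂ (λ a b → (t C k) * (b C k) ≤ (a C k) * (a C k)) t+k≡m∸k t+k+k≡m (C-log-concave t k k)
    where
    t = m ∸ (k + k)
    t+k+k≡m : t + k + k ≡ m
    t+k+k≡m = trans (ℕ.+-assoc t k k) (ℕ.m∸n+n≡m 2k≤m)
    t+k≡m∸k : t + k ≡ m ∸ k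
    t+k≡m∸k = trans (sym (ℕ.m+n∸n≡m (t + k) k)) (cong (_∸ k) t+k+k≡m)

  #noIsolated≤ : ∀ m k i → k + k ≤ m → let j = suc i; n = suc j; T = m C k; α = (m ∸ k) C k; N = T ^ n in
    .{{_ : NonZero T}} .{{_ : NonZero α}} →
    length (filter (λ F → noIsolatedVertex? (intersectionGraph F)) (assignments n m k)) * (n * α ^ j) + N * (n * α ^ j)
      ≤ N * T ^ j + N * (n * (T * α ^ i))
  #noIsolated≤ m k i 2k≤m = moment-quotient i {N₀ = N₀} {S₂ = S₂} (C-log-concave-∸ {m} {k} 2k≤m) (second-moment m k i)
    (subst₂ (λ N S₁ → N₀ * (S₁ * S₁) + N * (S₁ * S₁) ≤ N * N * S₂) (length-assignments n m k) (first-moment m k (suc i))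
      (subst (λ N₀ → N₀ * (S₁ * S₁) + length Ω * (S₁ * S₁) ≤ length Ω * length Ω * S₂) (sym (length-filter-∑∈ none? Ω))
        (chebyshev Ω isolated-number none? noIsolated⇒number≡0)))
    where
    n = suc (suc i)
    Ω = assignments n m k
    none? : Decidable (λ (F : Vec (Subset m) n) → NoIsolatedVertex (intersectionGraph F))
    none? F = noIsolatedVertex? (intersectionGraph F)
    N₀ = length (filter none? Ω)
    S₁ = ∑∈ Ω isolated-number
    S₂ = ∑[ F ∈ Ω ] (isolated-number F * isolated-number F)

-- Estimates in ℚ

module _ where
  open import Data.Integer.Base using (+_)
  open import Data.Rational.Base using (_/_; _+_; _-_; -_; _*_; _≤_; _<_)
  open Exp using (_^_)

  ι : ℕ → ℚ
  ι n = + n / 1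

  /-*-cancel : ∀ a b .{{_ : NonZero b}} → (+ a / b) * ι b ≡ ι a
  /-*-cancel a (suc b) = ℚ.toℚᵘ-injective (begin-equality
    toℚᵘ ((+ a / suc b) * ι (suc b))             ≃⟨ ℚ.toℚᵘ-homo-* (+ a / suc b) (ι (suc b)) ⟩
    toℚᵘ (+ a / suc b) ℚᵘ.* toℚᵘ (ι (suc b))     ≃⟨ ℚᵘ.*-cong (ℚ.toℚᵘ-fromℚᵘ (mkℚᵘ (+ a) b)) (ℚ.toℚᵘ-fromℚᵘ (mkℚᵘ (+ suc b) 0)) ⟩
    mkℚᵘ (+ a) b ℚᵘ.* mkℚᵘ (+ suc b) 0           ≃⟨ *≡* (trans (ℤ.*-identityʳ _) (cong (λ c → + a ℤ.* + suc c) (sym (ℕ.*-identityʳ b)))) ⟩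
    mkℚᵘ (+ a) 0                                 ≃⟨ ℚᵘ.≃-sym (ℚ.toℚᵘ-fromℚᵘ (mkℚᵘ (+ a) 0)) ⟩
    toℚᵘ (ι a)                                   ∎)
    where open ℚᵘ.≤-Reasoning

  ι-+ : ∀ a b → ι (a ℕ.+ b) ≡ ι a + ι b
  ι-+ a b = ℚ.toℚᵘ-injective (begin-equality
    toℚᵘ (ι (a ℕ.+ b))                 ≃⟨ ℚ.toℚᵘ-fromℚᵘ (mkℚᵘ (+ (a ℕ.+ b)) 0) ⟩
    mkℚᵘ (+ (a ℕ.+ b)) 0               ≃⟨ *≡* (cong (ℤ._* + 1) (sym (cong₂ ℤ._+_ (ℤ.*-identityʳ (+ a)) (ℤ.*-identityʳ (+ b))))) ⟩
    mkℚᵘ (+ a) 0 ℚᵘ.+ mkℚᵘ (+ b) 0     ≃⟨ ℚᵘ.≃-sym (ℚᵘ.+-cong (ℚ.toℚᵘ-fromℚᵘ (mkℚᵘ (+ a) 0)) (ℚ.toℚᵘ-fromℚᵘ (mkℚᵘ (+ b) 0))) ⟩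
    toℚᵘ (ι a) ℚᵘ.+ toℚᵘ (ι b)         ≃⟨ ℚᵘ.≃-sym (ℚ.toℚᵘ-homo-+ (ι a) (ι b)) ⟩
    toℚᵘ (ι a + ι b)                   ∎)
    where open ℚᵘ.≤-Reasoning

  ι-* : ∀ a b → ι (a ℕ.* b) ≡ ι a * ι b
  ι-* a b = ℚ.toℚᵘ-injective (begin-equality
    toℚᵘ (ι (a ℕ.* b))                 ≃⟨ ℚ.toℚᵘ-fromℚᵘ (mkℚᵘ (+ (a ℕ.* b)) 0) ⟩
    mkℚᵘ (+ (a ℕ.* b)) 0               ≃⟨ *≡* (cong (ℤ._* + 1) (ℤ.pos-* a b)) ⟩
    mkℚᵘ (+ a) 0 ℚᵘ.* mkℚᵘ (+ b) 0     ≃⟨ ℚᵘ.≃-sym (ℚᵘ.*-cong (ℚ.toℚᵘ-fromℚᵘ (mkℚᵘ (+ a) 0)) (ℚ.toℚᵘ-fromℚᵘ (mkℚᵘ (+ b) 0))) ⟩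
    toℚᵘ (ι a) ℚᵘ.* toℚᵘ (ι b)         ≃⟨ ℚᵘ.≃-sym (ℚ.toℚᵘ-homo-* (ι a) (ι b)) ⟩
    toℚᵘ (ι a * ι b)                   ∎)
    where open ℚᵘ.≤-Reasoning

  ι-suc : ∀ a → ι (suc a) ≡ 1ℚ + ι a
  ι-suc = ι-+ 1

  ι-^ : ∀ a c → ι (a ℕ.^ c) ≡ ι a ^ c
  ι-^ a zero    = refl
  ι-^ a (suc c) = trans (ι-* a (a ℕ.^ c)) (cong (ι a *_) (ι-^ a c))

  0≤ι : ∀ a → 0ℚ ≤ ι a
  0≤ι a = ℚ.nonNegative⁻¹ (ι a) {{ℚ.normalize-nonNeg a 1}}

  0<ι : ∀ a .{{_ : NonZero a}} → 0ℚ < ι a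
  0<ι (suc a) = ℚ.positive⁻¹ (ι (suc a)) {{ℚ.normalize-pos (suc a) 1}}

  -- The pattern of most estimates below: a witness for q - p ≥ 0 is assembled from known gaps by
  -- `_⊕_` and `_⊗_`, and the ring solver checks that it equals q - p.
  ≤-from-gap : ∀ {p q r} → 0ℚ ≤ r → q ≡ p + r → p ≤ q
  ≤-from-gap {p} {r = r} 0≤r refl = subst (_≤ p + r) (ℚ.+-identityʳ p) (ℚ.+-monoʳ-≤ p 0≤r)

  gap : ∀ {p q} → p ≤ q → 0ℚ ≤ q - p
  gap {p} {q} p≤q = subst (_≤ q - p) (ℚ.+-inverseʳ p) (ℚ.+-monoˡ-≤ (- p) p≤q)

  infixl 6 _⊕_
  infixl 7 _⊗_

  _⊕_ : ∀ {p q} → 0ℚ ≤ p → 0ℚ ≤ q → 0ℚ ≤ p + q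
  _⊕_ = ℚ.+-mono-≤

  _⊗_ : ∀ {p q} → 0ℚ ≤ p → 0ℚ ≤ q → 0ℚ ≤ p * q
  _⊗_ {p} {q} 0≤p 0≤q = ℚ.nonNegative⁻¹ (p * q)
    {{ℚ.nonNeg*nonNeg⇒nonNeg p {{ℚ.nonNegative 0≤p}} q {{ℚ.nonNegative 0≤q}}}}

  ι-mono : ∀ {a b} → a ℕ.≤ b → ι a ≤ ι b
  ι-mono {a} {b} a≤b = ≤-from-gap (0≤ι (b ℕ.∸ a)) (trans (cong ι (sym (ℕ.m+[n∸m]≡n a≤b))) (ι-+ a (b ℕ.∸ a)))

  ι-cancel-≤ : ∀ {a b} → ι a ≤ ι b → a ℕ.≤ b
  ι-cancel-≤ {a} {b} ιa≤ιb with a ℕ.≤? b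
  ... | yes a≤b = a≤b
  ... | no  a≰b = contradiction
    (ℚ.<-≤-trans (subst (_< 1ℚ + ι b) (ℚ.+-identityˡ (ι b)) (ℚ.+-monoˡ-< (ι b) (0<ι 1)))
      (ℚ.≤-trans (subst (_≤ ι a) (ι-suc b) (ι-mono (ℕ.≰⇒> a≰b))) ιa≤ιb))
    (ℚ.<-irrefl refl)

  cancel-≤ : ∀ r {p q} → 0ℚ < r → p * r ≤ q * r → p ≤ q
  cancel-≤ r 0<r = ℚ.*-cancelʳ-≤-pos r {{ℚ.positive 0<r}}

  0≤^ : ∀ {q} → 0ℚ ≤ q → ∀ c → 0ℚ ≤ q ^ c
  0≤^ 0≤q zero    = ℚ.<⇒≤ (0<ι 1)
  0≤^ 0≤q (suc c) = 0≤q ⊗ 0≤^ 0≤q c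

  ^-mono : ∀ {p q} → 0ℚ ≤ p → p ≤ q → ∀ c → p ^ c ≤ q ^ c
  ^-mono 0≤p p≤q zero = ℚ.≤-refl
  ^-mono {p} {q} 0≤p p≤q (suc c) =
    ≤-from-gap (gap p≤q ⊗ 0≤^ (ℚ.≤-trans 0≤p p≤q) c ⊕ 0≤p ⊗ gap (^-mono 0≤p p≤q c))
      (solve 4 (λ p q a b → q :* b := p :* a :+ ((q :- p) :* b :+ p :* (b :- a))) refl p q (p ^ c) (q ^ c))
    where open ℚ-Solver

  -- Finite products and the smoothing inequality

  ∏< : ℕ → (ℕ → ℚ) → ℚ
  ∏< zero    f = 1ℚ
  ∏< (suc c) f = f c * ∏< c f

  ∏-const : ∀ c q → ∏< c (λ _ → q) ≡ q ^ c
  ∏-const zero    q = refl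
  ∏-const (suc c) q = cong (q *_) (∏-const c q)

  0≤∏ : ∀ c {f} → (∀ j → 0ℚ ≤ f j) → 0ℚ ≤ ∏< c f
  0≤∏ zero    0≤f = ℚ.<⇒≤ (0<ι 1)
  0≤∏ (suc c) 0≤f = 0≤f c ⊗ 0≤∏ c 0≤f

  ∏≤1 : ∀ c {f} → (∀ j → 0ℚ ≤ f j) → (∀ j → f j ≤ 1ℚ) → ∏< c f ≤ 1ℚ
  ∏≤1 zero    0≤f f≤1 = ℚ.≤-refl
  ∏≤1 (suc c) {f} 0≤f f≤1 =
    ≤-from-gap (gap (f≤1 c) ⊕ 0≤f c ⊗ gap (∏≤1 c 0≤f f≤1))
      (solve 2 (λ x y → con 1ℚ := x :* y :+ ((con 1ℚ :- x) :+ x :* (con 1ℚ :- y))) refl (f c) (∏< c f))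
    where open ℚ-Solver

  0≤∑ : ∀ c {f} → (∀ j → 0ℚ ≤ f j) → 0ℚ ≤ ∑< c f
  0≤∑ zero    0≤f = ℚ.≤-refl
  0≤∑ (suc c) 0≤f = 0≤∑ c 0≤f ⊕ 0≤f c

  module _ {x y : ℕ → ℚ} (0≤x : ∀ j → 0ℚ ≤ x j) (x≤1 : ∀ j → x j ≤ 1ℚ) (0≤y : ∀ j → 0ℚ ≤ y j) where
    open ℚ-Solver

    private
      P Q : ℕ → ℚ
      P d = ∏< d (λ j → 1ℚ + y j)
      Q c = ∏< c (λ j → 1ℚ - x j)

      0≤P : ∀ d → 0ℚ ≤ P d
      0≤P d = 0≤∏ d (λ j → ℚ.<⇒≤ (0<ι 1) ⊕ 0≤y j)

      0≤Q : ∀ c → 0ℚ ≤ Q c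
      0≤Q c = 0≤∏ c (λ j → gap (x≤1 j))

      Q≤1 : ∀ c → Q c ≤ 1ℚ
      Q≤1 c = ∏≤1 c (λ j → gap (x≤1 j)) (λ j → ≤-from-gap (0≤x j) (solve 1 (λ x → con 1ℚ := con 1ℚ :- x :+ x) refl (x j)))

    -- Smoothing: factors on either side of 1 are merged by (1 + a)(1 + b) ≤ 1 + (a + b) when ab ≤ 0.
    ∏≤1-from-∑≤0 : ∀ c d a → 0ℚ ≤ 1ℚ + a → a + ∑< d y ≤ ∑< c x → (1ℚ + a) * (P d * Q c) ≤ 1ℚ
    -- Here 1 + a is the factor merged so far. It absorbs a y while a ≤ 0 and an x while a > 0, so
    -- it stays nonnegative. Once a ≤ 0 and no y is left, all factors are at most 1; if a > 0 and no
    -- x is left, the sum condition is violated.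
    ∏≤1-from-∑≤0 c d a 0≤1+a sum≤ with a ℚ.≤? 0ℚ
    ∏≤1-from-∑≤0 c zero a 0≤1+a sum≤ | yes a≤0 =
      ≤-from-gap (gap a≤0 ⊕ 0≤1+a ⊗ gap (Q≤1 c))
        (solve 2 (λ a q → con 1ℚ := (con 1ℚ :+ a) :* (con 1ℚ :* q) :+ ((con 0ℚ :- a) :+ (con 1ℚ :+ a) :* (con 1ℚ :- q))) refl a (Q c))
    ∏≤1-from-∑≤0 c (suc d) a 0≤1+a sum≤ | yes a≤0 =
      ℚ.≤-trans
        (≤-from-gap (gap a≤0 ⊗ 0≤y d ⊗ (0≤P d ⊗ 0≤Q c))
          (solve 4 (λ a y p q → (con 1ℚ :+ (a :+ y)) :* (p :* q) := (con 1ℚ :+ a) :* ((con 1ℚ :+ y) :* p :* q) :+ (con 0ℚ :- a) :* y :* (p :* q)) refl a (y d) (P d) (Q c)))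
        (∏≤1-from-∑≤0 c d (a + y d)
          (subst (0ℚ ≤_) (ℚ.+-assoc 1ℚ a (y d)) (0≤1+a ⊕ 0≤y d))
          (subst (_≤ ∑< c x) (solve 3 (λ a s y → a :+ (s :+ y) := a :+ y :+ s) refl a (∑< d y) (y d)) sum≤))
    ∏≤1-from-∑≤0 zero d a 0≤1+a sum≤ | no a≰0 =
      contradiction (ℚ.≤-trans (≤-from-gap (0≤∑ d 0≤y) refl) sum≤) a≰0
    ∏≤1-from-∑≤0 (suc c) d a 0≤1+a sum≤ | no a≰0 =
      ℚ.≤-trans
        (≤-from-gap (0≤a ⊗ 0≤x c ⊗ (0≤P d ⊗ 0≤Q c))
          (solve 4 (λ a x p q → (con 1ℚ :+ (a :- x)) :* (p :* q) := (con 1ℚ :+ a) :* (p :* ((con 1ℚ :- x) :* q)) :+ a :* x :* (p :* q)) refl a (x c) (P d) (Q c)))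
        (∏≤1-from-∑≤0 c d (a - x c)
          (subst (0ℚ ≤_) (solve 2 (λ a x → a :+ (con 1ℚ :- x) := con 1ℚ :+ (a :- x)) refl a (x c)) (0≤a ⊕ gap (x≤1 c)))
          (≤-from-gap (gap sum≤) (solve 4 (λ a s t x → t := a :- x :+ s :+ (t :+ x :- (a :+ s))) refl a (∑< d y) (∑< c x) (x c))))
      where
      0≤a : 0ℚ ≤ a
      0≤a = ℚ.<⇒≤ (ℚ.≰⇒> a≰0)

  -- Products and sums of 1/(j+3), and the tail estimates drawn from them

  ½≤1 : ℚ.½ ≤ 1ℚ
  ½≤1 = ℚ.≤ᵇ⇒≤ _

  -- The terms 1/(j+3) of the lower Riemann sum of mesh 1/2, so that `logApprox n 1` sums exactly
  -- these.
  h : ℕ → ℚ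
  h j = 1/1+ (2 ℕ.+ j)

  h-inverse : ∀ j → h j * ι (3 ℕ.+ j) ≡ 1ℚ
  h-inverse j = /-*-cancel 1 (3 ℕ.+ j)

  h≤½ : ∀ j → h j ≤ ℚ.½
  h≤½ j = 1/1+-anti {1} {2 ℕ.+ j} (ℕ.s≤s ℕ.z≤n)

  0≤h : ∀ j → 0ℚ ≤ h j
  0≤h j = 0≤1/1+ (2 ℕ.+ j)

  -- Telescopes, since 1 + h j = (4+j)/(3+j). At c = 2(n-1) the product is (2n+1)/3, at least n/3.
  ∏[1+h] : ∀ c → ∏< c (λ j → 1ℚ + h j) * ι 3 ≡ ι (3 ℕ.+ c)
  ∏[1+h] zero    = refl
  ∏[1+h] (suc c) = begin
    (1ℚ + h c) * p * ι 3             ≡⟨ ℚ.*-assoc (1ℚ + h c) p (ι 3) ⟩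
    (1ℚ + h c) * (p * ι 3)           ≡⟨ cong ((1ℚ + h c) *_) (∏[1+h] c) ⟩
    (1ℚ + h c) * ι (3 ℕ.+ c)         ≡⟨ ℚ.*-distribʳ-+ (ι (3 ℕ.+ c)) 1ℚ (h c) ⟩
    1ℚ * ι (3 ℕ.+ c) + h c * ι (3 ℕ.+ c) ≡⟨ cong₂ _+_ (ℚ.*-identityˡ (ι (3 ℕ.+ c))) (h-inverse c) ⟩
    ι (3 ℕ.+ c) + 1ℚ                 ≡⟨ ℚ.+-comm (ι (3 ℕ.+ c)) 1ℚ ⟩
    1ℚ + ι (3 ℕ.+ c)                 ≡⟨ sym (ι-suc (3 ℕ.+ c)) ⟩
    ι (4 ℕ.+ c)                      ∎
    where
    open ≡-Reasoning
    p = ∏< c (λ j → 1ℚ + h j)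

  -- Telescopes, since 1 - h j = (2+j)/(3+j). At c = 2(n-1) the product is exactly 1/n.
  ∏[1-h] : ∀ c → ∏< c (λ j → 1ℚ - h j) * ι (2 ℕ.+ c) ≡ ι 2
  ∏[1-h] zero    = refl
  ∏[1-h] (suc c) = begin
    (1ℚ - h c) * p * ι (3 ℕ.+ c)     ≡⟨ solve 3 (λ h p n → (con 1ℚ :- h) :* p :* n := p :* (n :- h :* n)) refl (h c) p (ι (3 ℕ.+ c)) ⟩
    p * (ι (3 ℕ.+ c) - h c * ι (3 ℕ.+ c)) ≡⟨ cong (p *_) (cong₂ _-_ (ι-suc (2 ℕ.+ c)) (h-inverse c)) ⟩
    p * (1ℚ + ι (2 ℕ.+ c) - 1ℚ)      ≡⟨ cong (p *_) (solve 1 (λ n → con 1ℚ :+ n :- con 1ℚ := n) refl (ι (2 ℕ.+ c))) ⟩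
    p * ι (2 ℕ.+ c)                  ≡⟨ ∏[1-h] c ⟩
    ι 2                              ∎
    where
    open ≡-Reasoning
    open ℚ-Solver
    p = ∏< c (λ j → 1ℚ - h j)

  -- H j = 1/3 + 1/4 + ⋯ + 1/(2j+2), the approximation of log (j+1) with mesh 1/2.
  H : ℕ → ℚ
  H j = logApprox (suc j) 1

  0≤H : ∀ j → 0ℚ ≤ H j
  0≤H j = 0≤∑ (j ℕ.* 2) 0≤h

  -- Each step from j to j+1 adds two terms, both at most 1/2.
  H≤ι : ∀ j → H j ≤ ι j
  H≤ι zero    = ℚ.≤-refl
  H≤ι (suc j) = subst (H (suc j) ≤_) (sym (ι-suc j))
    (≤-from-gap (gap (H≤ι j) ⊕ gap (h≤½ (j ℕ.* 2)) ⊕ gap (h≤½ (suc (j ℕ.* 2))))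
      (solve 4 (λ s a b t → con 1ℚ :+ t := s :+ a :+ b :+ (t :- s :+ (con ℚ.½ :- a) :+ (con ℚ.½ :- b))) refl
        (H j) (h (j ℕ.* 2)) (h (suc (j ℕ.* 2))) (ι j)))
    where open ℚ-Solver

  -- Stands in for (log n)² = O(n). The increment δ = a + b satisfies δ j ≤ 1, hence δ H ≤ 1 and δ²
  -- ≤ 1, so H² grows by 2δH + δ² ≤ 3.
  H²≤3ι : ∀ j → H j * H j ≤ ι 3 * ι j
  H²≤3ι zero    = ℚ.≤-refl
  H²≤3ι (suc j) = subst (λ t → H (suc j) * H (suc j) ≤ ι 3 * t) (sym (ι-suc j))
    (≤-from-gap (gap (H²≤3ι j) ⊕ gap δS≤1 ⊕ gap δS≤1 ⊕ gap δ²≤1)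
      (solve 4 (λ s a b t → con (ι 3) :* (con 1ℚ :+ t) := (s :+ a :+ b) :* (s :+ a :+ b) :+
        (con (ι 3) :* t :- s :* s :+ (con 1ℚ :- (a :+ b) :* s) :+ (con 1ℚ :- (a :+ b) :* s) :+ (con 1ℚ :- (a :+ b) :* (a :+ b)))) refl (H j) a b (ι j)))
    where
    open ℚ-Solver
    a = h (j ℕ.* 2)
    b = h (suc (j ℕ.* 2))
    0≤a+b : 0ℚ ≤ a + b
    0≤a+b = 0≤h (j ℕ.* 2) ⊕ 0≤h (suc (j ℕ.* 2))
    ι-index : ∀ i → ι (i ℕ.+ j ℕ.* 2) ≡ ι i + ι j * ι 2
    ι-index i = trans (ι-+ i (j ℕ.* 2)) (cong (λ t → ι i + t) (ι-* j 2))
    double-a : a * (ι 3 + ι j * ι 2) ≡ 1ℚ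
    double-a = trans (cong (a *_) (sym (ι-index 3))) (h-inverse (j ℕ.* 2))
    double-b : b * (ι 4 + ι j * ι 2) ≡ 1ℚ
    double-b = trans (cong (b *_) (sym (ι-index 4))) (h-inverse (suc (j ℕ.* 2)))
    δι≤1 : (a + b) * ι j ≤ 1ℚ
    -- Half the sum of a(2j+3) = 1 and b(2j+4) = 1; the remainder 3a/2 + 2b is nonnegative.
    δι≤1 = ≤-from-gap (0≤h (j ℕ.* 2) ⊗ ℚ.<⇒≤ (0<ι 1) ⊕ 0≤h (suc (j ℕ.* 2)) ⊗ 0≤ι 2 ⊕ 0≤h (j ℕ.* 2) ⊗ ℚ.≤ᵇ⇒≤ _)
      (begin
        1ℚ                                         ≡⟨⟩
        ℚ.½ * (1ℚ + 1ℚ)                            ≡⟨ cong (ℚ.½ *_) (cong₂ _+_ (sym double-a) (sym double-b)) ⟩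
        ℚ.½ * (a * (ι 3 + ι j * ι 2) + b * (ι 4 + ι j * ι 2))
          ≡⟨ solve 3 (λ a b t → con ℚ.½ :* (a :* (con (ι 3) :+ t :* con (ι 2)) :+ b :* (con (ι 4) :+ t :* con (ι 2)))
                := (a :+ b) :* t :+ (a :* con 1ℚ :+ b :* con (ι 2) :+ a :* con ℚ.½)) refl a b (ι j) ⟩
        (a + b) * ι j + (a * 1ℚ + b * ι 2 + a * ℚ.½) ∎)
      where open ≡-Reasoning
    δS≤1 : (a + b) * H j ≤ 1ℚ
    δS≤1 = ℚ.≤-trans (≤-from-gap (0≤a+b ⊗ gap (H≤ι j)) (solve 3 (λ d s t → d :* t := d :* s :+ d :* (t :- s)) refl (a + b) (H j) (ι j))) δι≤1
    δ≤1 : a + b ≤ 1ℚ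
    δ≤1 = ℚ.+-mono-≤ (h≤½ (j ℕ.* 2)) (h≤½ (suc (j ℕ.* 2)))
    δ²≤1 : (a + b) * (a + b) ≤ 1ℚ
    δ²≤1 = ≤-from-gap (gap δ≤1 ⊗ (ℚ.<⇒≤ (0<ι 1) ⊕ 0≤a+b)) (solve 1 (λ d → con 1ℚ := d :* d :+ (con 1ℚ :- d) :* (con 1ℚ :+ d)) refl (a + b))

  -- Replace n by its bound 3 ∏(1 + h). The factors 1 + K, 1 + h and L copies of 1 - x then have
  -- deviations adding up to K + H - Lx ≤ 0, and smoothing applies; the 3 on the right is the lost
  -- constant.
  upper-tail : ∀ j L {x K} → 0ℚ ≤ x → x ≤ 1ℚ → 0ℚ ≤ K → K + H j ≤ ι L * x →
    (1ℚ + K) * ((1ℚ - x) ^ L * ι (suc j)) ≤ ι 3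
  upper-tail j L {x} {K} 0≤x x≤1 0≤K cond = ℚ.≤-trans
    (≤-from-gap ((ℚ.<⇒≤ (0<ι 1) ⊕ 0≤K) ⊗ 0≤^ (gap x≤1) L ⊗ gap n≤P3)
      (solve 4 (λ k u p n → (con 1ℚ :+ k) :* (p :* u) :* con (ι 3) := (con 1ℚ :+ k) :* (u :* n) :+ (con 1ℚ :+ k) :* u :* (p :* con (ι 3) :- n)) refl K ((1ℚ - x) ^ L) p (ι (suc j))))
    (subst ((1ℚ + K) * (p * (1ℚ - x) ^ L) * ι 3 ≤_) (ℚ.*-identityˡ (ι 3))
      (ℚ.*-monoʳ-≤-nonNeg (ι 3)
        (subst (λ u → (1ℚ + K) * (p * u) ≤ 1ℚ) (∏-const L (1ℚ - x))
          (∏≤1-from-∑≤0 (λ _ → 0≤x) (λ _ → x≤1) 0≤h L (j ℕ.* 2) K (ℚ.<⇒≤ (0<ι 1) ⊕ 0≤K)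
            (subst (K + H j ≤_) (sym (∑-const L x)) cond)))))
    where
    open ℚ-Solver
    p = ∏< (j ℕ.* 2) (λ j → 1ℚ + h j)
    n≤P3 : ι (suc j) ≤ p * ι 3
    n≤P3 = subst (ι (suc j) ≤_) (sym (∏[1+h] (j ℕ.* 2)))
      (ι-mono (ℕ.s≤s (ℕ.≤-trans (ℕ.m≤m*n j 2) (ℕ.m≤n+m (j ℕ.* 2) 2))))

  -- Since 1/n = ∏(1 - h), the claim is that (1 + K) rʲ ∏(1 - h) ≤ 1, whose deviations add up to K +
  -- j(r - 1) - H ≤ 0. It is used with r = T/α, where n/rʲ is the expected number of isolated
  -- vertices.
  lower-tail : ∀ j {r K} → 1ℚ ≤ r → 0ℚ ≤ K → K + ι j * (r - 1ℚ) ≤ H j →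
    (1ℚ + K) * r ^ j ≤ ι (suc j)
  lower-tail j {r} {K} 1≤r 0≤K cond = begin
    (1ℚ + K) * r ^ j                         ≡⟨ ℚ.*-identityʳ _ ⟨
    (1ℚ + K) * r ^ j * 1ℚ                    ≡⟨ cong ((1ℚ + K) * r ^ j *_) (sym Qn) ⟩
    (1ℚ + K) * r ^ j * (q * ι (suc j))       ≡⟨ solve 4 (λ k u q n → (con 1ℚ :+ k) :* u :* (q :* n) := (con 1ℚ :+ k) :* (u :* q) :* n) refl K (r ^ j) q (ι (suc j)) ⟩
    (1ℚ + K) * (r ^ j * q) * ι (suc j)       ≤⟨ ℚ.*-monoʳ-≤-nonNeg (ι (suc j)) {{ℚ.nonNegative (0≤ι (suc j))}} smoothing ⟩
    1ℚ * ι (suc j)                           ≡⟨ ℚ.*-identityˡ _ ⟩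
    ι (suc j)                                ∎
    where
    open ℚ-Solver
    open ℚ.≤-Reasoning
    q = ∏< (j ℕ.* 2) (λ j → 1ℚ - h j)
    Qn : q * ι (suc j) ≡ 1ℚ
    Qn = begin-equality
      q * ι (suc j)                  ≡⟨ solve 2 (λ q n → q :* n := q :* (n :* con (ι 2)) :* con ℚ.½) refl q (ι (suc j)) ⟩
      q * (ι (suc j) * ι 2) * ℚ.½    ≡⟨ cong (λ t → q * t * ℚ.½) (sym (ι-* (suc j) 2)) ⟩
      q * ι (2 ℕ.+ j ℕ.* 2) * ℚ.½    ≡⟨ cong (_* ℚ.½) (∏[1-h] (j ℕ.* 2)) ⟩
      1ℚ                             ∎
    smoothing : (1ℚ + K) * (r ^ j * q) ≤ 1ℚ
    smoothing = subst (λ u → (1ℚ + K) * (u * q) ≤ 1ℚ)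
      (trans (∏-const j _) (cong (_^ j) (solve 1 (λ r → con 1ℚ :+ (r :- con 1ℚ) := r) refl r)))
      (∏≤1-from-∑≤0 0≤h (λ j → ℚ.≤-trans (h≤½ j) ½≤1) (λ _ → gap 1≤r) (j ℕ.* 2) j K (ℚ.<⇒≤ (0<ι 1) ⊕ 0≤K)
        (subst (λ s → K + s ≤ H j) (sym (∑-const j (r - 1ℚ))) cond))

  -- Passing from n = j+1 to j costs a factor j/n, which is at least 1/2 but cannot be replaced by a
  -- small additive error, as z need not be bounded. After multiplication by n the slack is (j - 1)K
  -- + (j - H) + j, which explains the surplus 2K + 2.
  excess : ∀ j .{{_ : NonZero j}} {z K} → 0ℚ ≤ K → H j + (ι 2 * K + ι 2) ≤ ι (suc j) * z → K + H j ≤ ι j * z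
  excess j@(suc i) {z} {K} 0≤K big = cancel-≤ (ι (suc j)) (0<ι (suc j))
    (≤-from-gap (0≤ι j ⊗ gap big ⊕ gap (H≤ι j) ⊕ 0≤ι i ⊗ 0≤K ⊕ 0≤ι j)
      (subst (λ t → ι j * z * t ≡ (K + H j) * t + (ι j * (t * z - (H j + (ι 2 * K + ι 2))) + (ι j - H j) + ι i * K + ι j))
        (sym (ι-suc j))
        (trans
          (solve 4 (λ z k s t → t :* z :* (con 1ℚ :+ t) := (k :+ s) :* (con 1ℚ :+ t) :+
             (t :* ((con 1ℚ :+ t) :* z :- (s :+ (con (ι 2) :* k :+ con (ι 2)))) :+ (t :- s) :+ (t :- con 1ℚ) :* k :+ t)) refl z K (H j) (ι j))
          (cong (λ w → (K + H j) * (1ℚ + ι j) + (ι j * ((1ℚ + ι j) * z - (H j + (ι 2 * K + ι 2))) + (ι j - H j) + w * K + ι j))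
            (trans (cong (_- 1ℚ) (ι-suc i)) (solve 1 (λ i → con 1ℚ :+ i :- con 1ℚ := i) refl (ι i)))))))
    where open ℚ-Solver

  -- Here (nz)² ≤ H² ≤ 3j ≤ 3n, and one n is cancelled.
  nz²≤3 : ∀ j {z} → 0ℚ ≤ z → ι (suc j) * z ≤ H j → ι (suc j) * (z * z) ≤ ι 3
  nz²≤3 j {z} 0≤z nz≤H = cancel-≤ n (0<ι (suc j)) (begin
    n * (z * z) * n      ≡⟨ solve 2 (λ n z → n :* (z :* z) :* n := n :* z :* (n :* z)) refl n z ⟩
    n * z * (n * z)      ≤⟨ ≤-from-gap (gap nz≤H ⊗ (0≤H j ⊕ 0≤ι (suc j) ⊗ 0≤z)) (solve 2 (λ s t → s :* s := t :* t :+ (s :- t) :* (s :+ t)) refl (H j) (n * z)) ⟩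
    H j * H j            ≤⟨ H²≤3ι j ⟩
    ι 3 * ι j            ≤⟨ ℚ.*-monoˡ-≤-nonNeg (ι 3) (ι-mono (ℕ.n≤1+n j)) ⟩
    ι 3 * n              ∎)
    where
    open ℚ-Solver
    open ℚ.≤-Reasoning
    n = ι (suc j)

  square-cancel : ∀ {y d} → 0ℚ ≤ y → 0ℚ < d → y * y ≤ d * d → y ≤ d
  square-cancel {y} {d} 0≤y 0<d y²≤d² = cancel-≤ (y + d) (ℚ.+-mono-≤-< 0≤y 0<d)
    (≤-from-gap (gap y²≤d²) (solve 2 (λ y d → d :* (y :+ d) := y :* (y :+ d) :+ (d :* d :- y :* y)) refl y d))
    where open ℚ-Solver

  -- Expresses z ≤ √(3/n) ≤ d without square roots.
  square-bound : ∀ j {z d} → 0ℚ ≤ z → 0ℚ < d → ι (suc j) * (z * z) ≤ ι 3 → ι 3 ≤ ι (suc j) * (d * d) → z ≤ d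
  square-bound j {z} {d} 0≤z 0<d z≤ ≤d = square-cancel 0≤z 0<d
    (ℚ.*-cancelˡ-≤-pos (ι (suc j)) {{ℚ.positive (0<ι (suc j))}} (ℚ.≤-trans z≤ ≤d))

  -- The assumption says r ≤ 1/(1 - z), and 1/(1 - z) - 1 = z + z²/(1 - z), where 1/(1 - z) ≤ 2 for
  -- z ≤ 1/2.
  ratio-bound : ∀ {r z} → 0ℚ ≤ z → z ≤ ℚ.½ → r ≤ 1ℚ + z * r → r - 1ℚ ≤ z + ι 2 * (z * z)
  ratio-bound {r} {z} 0≤z z≤½ r≤ = cancel-≤ (1ℚ - z) 0<1-z
    (≤-from-gap (gap r≤ ⊕ 0≤z ⊗ 0≤z ⊗ (gap z≤½ ⊕ gap z≤½))
      (solve 2 (λ r z → (z :+ con (ι 2) :* (z :* z)) :* (con 1ℚ :- z) := (r :- con 1ℚ) :* (con 1ℚ :- z) :+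
        (con 1ℚ :+ z :* r :- r :+ z :* z :* (con ℚ.½ :- z :+ (con ℚ.½ :- z)))) refl r z))
    where
    open ℚ-Solver
    0<1-z : 0ℚ < 1ℚ - z
    0<1-z = ℚ.<-≤-trans (ℚ.positive⁻¹ ℚ.½) (≤-from-gap (gap z≤½) (solve 1 (λ z → con 1ℚ :- z := con ℚ.½ :+ (con ℚ.½ :- z)) refl z))

  -- Here j(r - 1) ≤ nz + 2nz² ≤ nz + 6, so the constant 6 in the assumption pays for the
  -- second-order term.
  deficit : ∀ j {r z K} → 0ℚ ≤ z → 0ℚ ≤ K → r - 1ℚ ≤ z + ι 2 * (z * z) → ι (suc j) * (z * z) ≤ ι 3 →
    ι (suc j) * z + (K + ι 6) ≤ H j → K + ι j * (r - 1ℚ) ≤ H j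
  deficit j {r} {z} {K} 0≤z 0≤K r≤ nz² cond =
    ≤-from-gap (gap cond ⊕ 0≤ι 2 ⊗ gap nz² ⊕ 0≤ι j ⊗ gap r≤ ⊕ (0≤z ⊕ 0≤ι 2 ⊗ (0≤z ⊗ 0≤z)))
      (subst (λ n → H j ≡ K + ι j * (r - 1ℚ) + (H j - (n * z + (K + ι 6)) + ι 2 * (ι 3 - n * (z * z)) + ι j * (z + ι 2 * (z * z) - (r - 1ℚ)) + (z + ι 2 * (z * z))))
        (sym (ι-suc j))
        (solve 5 (λ s k t r z → s := k :+ t :* (r :- con 1ℚ) :+ (s :- ((con 1ℚ :+ t) :* z :+ (k :+ con (ι 6))) :+ con (ι 2) :* (con (ι 3) :- (con 1ℚ :+ t) :* (z :* z))
           :+ t :* (z :+ con (ι 2) :* (z :* z) :- (r :- con 1ℚ)) :+ (z :+ con (ι 2) :* (z :* z)))) refl (H j) K (ι j) r z))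
    where open ℚ-Solver

  -- From real hypotheses to rational inequalities

  p≤∣p∣ : ∀ p → p ≤ ℚ.∣ p ∣
  p≤∣p∣ p with ℚ.≤-total 0ℚ p
  ... | inj₁ 0≤p = ℚ.≤-reflexive (sym (ℚ.0≤p⇒∣p∣≡p 0≤p))
  ... | inj₂ p≤0 = ℚ.≤-trans p≤0 (ℚ.0≤∣p∣ p)

  -p≤∣p∣ : ∀ p → - p ≤ ℚ.∣ p ∣
  -p≤∣p∣ p = subst (- p ≤_) (ℚ.∣-p∣≡∣p∣ p) (p≤∣p∣ (- p))

  -- The equation is used at index 0, where `_+ᴿ_` evaluates both summands at `double 0`, that is 1,
  -- and log becomes H. Its tolerance is 2, that of the bound on ω at index 1 is 1, whence the 3.
  ≃-log+ω : ∀ j {q K ω} → fromℚ (K + ι 3) ≤ᴿ ω → fromℚ q ≃ log (suc j) +ᴿ ω → H j + K ≤ q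
  ≃-log+ω j {q} {K} {ω} K≤ω q≃ =
    ≤-from-gap (gap (K≤ω 1) ⊕ gap (ℚ.≤-trans (-p≤∣p∣ _) (q≃ 0)))
      (solve 4 (λ q s w k → q := s :+ k :+ (w :+ con 1ℚ :- (k :+ con (ι 3)) :+ (con (ι 2) :- (:- (q :- (s :+ w)))))) refl q (H j) (approx ω 1) K)
    where open ℚ-Solver

  ≃-log-ω : ∀ j {q K ω} → fromℚ (K + ι 3) ≤ᴿ ω → fromℚ q ≃ log (suc j) -ᴿ ω → q + K ≤ H j
  ≃-log-ω j {q} {K} {ω} K≤ω q≃ =
    ≤-from-gap (gap (K≤ω 1) ⊕ gap (ℚ.≤-trans (p≤∣p∣ _) (q≃ 0)))
      (solve 4 (λ q s w k → s := q :+ k :+ (w :+ con 1ℚ :- (k :+ con (ι 3)) :+ (con (ι 2) :- (q :- (s :- w))))) refl q (H j) (approx ω 1) K)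
    where open ℚ-Solver

  archimedean : ∀ q → ∃ λ N → q ≤ ι N
  archimedean q@(ℚ.mkℚ a d-1 _) = ℤ.∣ a ∣ , ℚ.toℚᵘ-cancel-≤ (ℚᵘ.≤-respʳ-≃ (ℚᵘ.≃-sym (ℚ.toℚᵘ-fromℚᵘ (mkℚᵘ (+ ℤ.∣ a ∣) 0))) (*≤* (lemma a)))
    where
    lemma : ∀ a → a ℤ.* + 1 ℤ.≤ + ℤ.∣ a ∣ ℤ.* + suc d-1
    lemma (+ a)        = subst₂ ℤ._≤_ (sym (ℤ.*-identityʳ (+ a))) (ℤ.pos-* a (suc d-1)) (ℤ.+≤+ (ℕ.m≤m*n a (suc d-1)))
    lemma ℤ.-[1+ a ] = ℤ.-≤+

  inverse : ∀ {ε} → 0ℚ < ε → ∃ λ e → 0ℚ ≤ e × e * ε ≡ 1ℚ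
  inverse {ε} 0<ε = ℚ.1/ ε , ℚ.<⇒≤ (ℚ.positive⁻¹ _ {{ℚ.1/pos⇒pos ε}}) , ℚ.*-inverseˡ ε
    where instance
    _ = ℚ.positive 0<ε
    _ = ℚ.pos⇒nonZero ε

  [1-a/N]*N : ∀ a N₀ N .{{_ : NonZero N}} → a ℕ.+ N₀ ≡ N → (1ℚ - + a / N) * ι N ≡ ι N₀
  [1-a/N]*N a N₀ N eq = begin
    (1ℚ - + a / N) * ι N      ≡⟨ solve 2 (λ p n → (con 1ℚ :- p) :* n := n :- p :* n) refl (+ a / N) (ι N) ⟩
    ι N - (+ a / N) * ι N     ≡⟨ cong₂ _-_ (trans (cong ι (sym eq)) (ι-+ a N₀)) (/-*-cancel a N) ⟩
    ι a + ι N₀ - ι a          ≡⟨ solve 2 (λ a b → a :+ b :- a := b) refl (ι a) (ι N₀) ⟩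
    ι N₀                      ∎
    where
    open ≡-Reasoning
    open ℚ-Solver

  ∣a/N-1∣≡1-a/N : ∀ a N₀ N .{{_ : NonZero N}} → a ℕ.+ N₀ ≡ N → ℚ.∣ + a / N - 1ℚ ∣ ≡ 1ℚ - + a / N
  ∣a/N-1∣≡1-a/N a N₀ N eq = begin
    ℚ.∣ p - 1ℚ ∣         ≡⟨ ℚ.∣-p∣≡∣p∣ (p - 1ℚ) ⟨
    ℚ.∣ - (p - 1ℚ) ∣     ≡⟨ cong ℚ.∣_∣ (solve 1 (λ p → :- (p :- con 1ℚ) := con 1ℚ :- p) refl p) ⟩
    ℚ.∣ 1ℚ - p ∣         ≡⟨ ℚ.0≤p⇒∣p∣≡p (cancel-≤ (ι N) (0<ι N) (subst₂ _≤_ (sym (ℚ.*-zeroˡ (ι N))) (sym ([1-a/N]*N a N₀ N eq)) (0≤ι N₀))) ⟩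
    1ℚ - p               ∎
    where
    open ≡-Reasoning
    open ℚ-Solver
    p = + a / N

  ι-≤-+ : ∀ {a b c} → a ℕ.≤ b ℕ.+ c → ι a ≤ ι b + ι c
  ι-≤-+ {a} {b} {c} le = subst (ι a ≤_) (ι-+ b c) (ι-mono le)

  -- Probability bounds for fixed n, m and k

  module _ (m k : ℕ) .{{_ : NonZero m}} (k≤m : k ℕ.≤ m) where
    open ℚ-Solver

    private
      x : ℚ
      x = + k / m

      xm : x * ι m ≡ ι k
      xm = /-*-cancel k m

    0≤k/m : 0ℚ ≤ x
    0≤k/m = cancel-≤ (ι m) (0<ι m) (subst₂ _≤_ (sym (ℚ.*-zeroˡ (ι m))) (sym xm) (0≤ι k))

    k/m≤1 : x ≤ 1ℚ
    k/m≤1 = cancel-≤ (ι m) (0<ι m) (subst₂ _≤_ (sym xm) (sym (ℚ.*-identityˡ (ι m))) (ι-mono k≤m))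

    k²n/m≡n*[k*[k/m]] : ∀ n → + (k ℕ.^ 2 ℕ.* n) / m ≡ ι n * (ι k * x)
    k²n/m≡n*[k*[k/m]] n = ℚ.≤-antisym (cancel-≤ (ι m) (0<ι m) (ℚ.≤-reflexive eq)) (cancel-≤ (ι m) (0<ι m) (ℚ.≤-reflexive (sym eq)))
      where
      open ≡-Reasoning
      eq : (+ (k ℕ.^ 2 ℕ.* n) / m) * ι m ≡ ι n * (ι k * x) * ι m
      eq = begin
        (+ (k ℕ.^ 2 ℕ.* n) / m) * ι m    ≡⟨ /-*-cancel (k ℕ.^ 2 ℕ.* n) m ⟩
        ι (k ℕ.^ 2 ℕ.* n)                ≡⟨ trans (ι-* (k ℕ.^ 2) n) (cong (_* ι n) (ι-^ k 2)) ⟩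
        ι k * (ι k * 1ℚ) * ι n           ≡⟨ solve 2 (λ k n → k :* (k :* con 1ℚ) :* n := n :* (k :* k)) refl (ι k) (ι n) ⟩
        ι n * (ι k * ι k)                ≡⟨ cong (λ t → ι n * (ι k * t)) (sym xm) ⟩
        ι n * (ι k * (x * ι m))          ≡⟨ solve 4 (λ n k x m → n :* (k :* (x :* m)) := n :* (k :* x) :* m) refl (ι n) (ι k) x (ι m) ⟩
        ι n * (ι k * x) * ι m            ∎

    ≤-[1-k/m]^k : ∀ A T → A ℕ.* m ℕ.^ k ℕ.≤ (m ℕ.∸ k) ℕ.^ k ℕ.* T → ι A ≤ (1ℚ - x) ^ k * ι T
    ≤-[1-k/m]^k A T le = cancel-≤ (ι (m ℕ.^ k)) (0<ι (m ℕ.^ k) {{ℕ.m^n≢0 m k}}) (begin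
      ι A * ι (m ℕ.^ k)                      ≡⟨ ι-* A (m ℕ.^ k) ⟨
      ι (A ℕ.* m ℕ.^ k)                      ≤⟨ ι-mono le ⟩
      ι ((m ℕ.∸ k) ℕ.^ k ℕ.* T)              ≡⟨ trans (ι-* ((m ℕ.∸ k) ℕ.^ k) T) (cong (_* ι T) (ι-^ (m ℕ.∸ k) k)) ⟩
      ι (m ℕ.∸ k) ^ k * ι T                  ≡⟨ cong (λ t → t ^ k * ι T) m-k ⟩
      ((1ℚ - x) * ι m) ^ k * ι T             ≡⟨ cong (_* ι T) (Exp.^-distrib-* (1ℚ - x) (ι m) k) ⟩
      (1ℚ - x) ^ k * ι m ^ k * ι T           ≡⟨ cong (λ t → (1ℚ - x) ^ k * t * ι T) (sym (ι-^ m k)) ⟩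
      (1ℚ - x) ^ k * ι (m ℕ.^ k) * ι T       ≡⟨ solve 3 (λ a b c → a :* b :* c := a :* c :* b) refl ((1ℚ - x) ^ k) (ι (m ℕ.^ k)) (ι T) ⟩
      (1ℚ - x) ^ k * ι T * ι (m ℕ.^ k)       ∎)
      where
      open ℚ.≤-Reasoning
      m-k : ι (m ℕ.∸ k) ≡ (1ℚ - x) * ι m
      m-k = begin-equality
        ι (m ℕ.∸ k)                 ≡⟨ solve 2 (λ a b → a := a :+ b :- b) refl (ι (m ℕ.∸ k)) (ι k) ⟩
        ι (m ℕ.∸ k) + ι k - ι k     ≡⟨ cong₂ _-_ (trans (sym (ι-+ (m ℕ.∸ k) k)) (cong ι (ℕ.m∸n+n≡m k≤m))) (sym xm) ⟩
        ι m - x * ι m               ≡⟨ solve 2 (λ m x → m :- x :* m := (con 1ℚ :- x) :* m) refl (ι m) x ⟩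
        (1ℚ - x) * ι m              ∎

    -- In effect (1 + K) P(X > 0) ≤ 3. The bound α ≤ (1 - k/m)ᵏ T enters n(α/T)ʲ as kj equal factors
    -- 1 - k/m, whose deviations sum to -jk²/m.
    first-moment-bound : ∀ j .{{_ : NonZero j}} {N₀ A T K} → 0ℚ ≤ K →
      H j + (ι 2 * K + ι 2) ≤ + (k ℕ.^ 2 ℕ.* suc j) / m →
      A ℕ.* m ℕ.^ k ℕ.≤ (m ℕ.∸ k) ℕ.^ k ℕ.* T → N₀ ℕ.≤ suc j ℕ.* (T ℕ.* A ℕ.^ j) →
      (1ℚ + K) * ι N₀ ≤ ι 3 * ι (T ℕ.^ suc j)
    first-moment-bound j {N₀} {A} {T} {K} 0≤K big A≤ N₀≤ = begin
      (1ℚ + K) * ι N₀                                ≤⟨ ℚ.*-monoˡ-≤-nonNeg (1ℚ + K) {{nn}} (ι-mono N₀≤) ⟩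
      (1ℚ + K) * ι (suc j ℕ.* (T ℕ.* A ℕ.^ j))       ≡⟨ cong ((1ℚ + K) *_) (trans (ι-* (suc j) (T ℕ.* A ℕ.^ j)) (cong (n *_) (trans (ι-* T (A ℕ.^ j)) (cong (ι T *_) (ι-^ A j))))) ⟩
      (1ℚ + K) * (n * (ι T * ι A ^ j))               ≤⟨ ℚ.*-monoˡ-≤-nonNeg (1ℚ + K) {{nn}} (ℚ.*-monoˡ-≤-nonNeg n {{ℚ.nonNegative (0≤ι (suc j))}} (ℚ.*-monoˡ-≤-nonNeg (ι T) {{ℚ.nonNegative (0≤ι T)}} (^-mono (0≤ι A) (≤-[1-k/m]^k A T A≤) j))) ⟩
      (1ℚ + K) * (n * (ι T * (u ^ k * ι T) ^ j))     ≡⟨ cong (λ t → (1ℚ + K) * (n * (ι T * t))) (trans (Exp.^-distrib-* (u ^ k) (ι T) j) (cong (_* ι T ^ j) (Exp.^-assocʳ u k j))) ⟩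
      (1ℚ + K) * (n * (ι T * (u ^ (k ℕ.* j) * ι T ^ j))) ≡⟨ solve 5 (λ a n t v w → a :* (n :* (t :* (v :* w))) := a :* (v :* n) :* (t :* w)) refl (1ℚ + K) n (ι T) (u ^ (k ℕ.* j)) (ι T ^ j) ⟩
      (1ℚ + K) * (u ^ (k ℕ.* j) * n) * ι T ^ suc j   ≤⟨ ℚ.*-monoʳ-≤-nonNeg (ι T ^ suc j) {{ℚ.nonNegative (0≤^ (0≤ι T) (suc j))}} (upper-tail j (k ℕ.* j) 0≤k/m k/m≤1 0≤K cond) ⟩
      ι 3 * ι T ^ suc j                              ≡⟨ cong (ι 3 *_) (sym (ι-^ T (suc j))) ⟩
      ι 3 * ι (T ℕ.^ suc j)                          ∎
      where
      open ℚ.≤-Reasoning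
      u = 1ℚ - x
      n = ι (suc j)
      nn = ℚ.nonNegative (ℚ.<⇒≤ (0<ι 1) ⊕ 0≤K)
      cond : K + H j ≤ ι (k ℕ.* j) * x
      cond = subst (K + H j ≤_)
        (trans (solve 3 (λ j k x → j :* (k :* x) := k :* j :* x) refl (ι j) (ι k) x) (cong (_* x) (sym (ι-* k j))))
        (excess j 0≤K (subst (H j + (ι 2 * K + ι 2) ≤_) (k²n/m≡n*[k*[k/m]] (suc j)) big))

    -- Below the threshold nz ≤ H for z = k²/m, so z is at most of order 1/√n and falls below any
    -- fixed d for large n.
    k²/m≤ : ∀ j {K d} → 0ℚ ≤ K → + (k ℕ.^ 2 ℕ.* suc j) / m + K ≤ H j → 0ℚ < d → ι 3 ≤ ι (suc j) * (d * d) →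
      ι k * x ≤ d
    k²/m≤ j {K} {d} 0≤K small-q 0<d 3≤nd² = square-bound j 0≤z 0<d (nz²≤3 j 0≤z nz≤H) 3≤nd²
      where
      0≤z : 0ℚ ≤ ι k * x
      0≤z = 0≤ι k ⊗ 0≤k/m
      nz≤H : ι (suc j) * (ι k * x) ≤ H j
      nz≤H = ℚ.≤-trans (≤-from-gap 0≤K refl) (subst (λ q → q + K ≤ H j) (k²n/m≡n*[k*[k/m]] (suc j)) small-q)

    2k²≤m : ι k * x ≤ ℚ.½ → 2 ℕ.* (k ℕ.* k) ℕ.≤ m
    2k²≤m z≤½ = ι-cancel-≤ (begin
      ι (2 ℕ.* (k ℕ.* k))      ≡⟨ trans (ι-* 2 (k ℕ.* k)) (cong (ι 2 *_) (ι-* k k)) ⟩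
      ι 2 * (ι k * ι k)        ≡⟨ cong (λ t → ι 2 * (ι k * t)) (sym xm) ⟩
      ι 2 * (ι k * (x * ι m))  ≡⟨ solve 3 (λ k x m → con (ι 2) :* (k :* (x :* m)) := k :* x :* (con (ι 2) :* m)) refl (ι k) x (ι m) ⟩
      ι k * x * (ι 2 * ι m)    ≤⟨ ℚ.*-monoʳ-≤-nonNeg (ι 2 * ι m) {{ℚ.nonNegative (0≤ι 2 ⊗ 0≤ι m)}} z≤½ ⟩
      ℚ.½ * (ι 2 * ι m)        ≡⟨ solve 1 (λ m → con ℚ.½ :* (con (ι 2) :* m) := m) refl (ι m) ⟩
      ι m                      ∎)
      where open ℚ.≤-Reasoning

    -- In effect P(X = 0) ≤ 1/(1 + K) + 2d. With r = T/α, the first term bounds rʲ/n = 1/E X and the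
    -- second bounds r - 1.
    second-moment-bound : ∀ i {N₀ A T K d} .{{_ : NonZero A}} → let j = suc i; n = suc j; N = T ℕ.^ n in
      0ℚ ≤ K → + (k ℕ.^ 2 ℕ.* n) / m + (K + ι 6) ≤ H j → ι k * x ≤ ℚ.½ → ι k * x ≤ d →
      A ℕ.≤ T → m ℕ.* T ℕ.≤ m ℕ.* A ℕ.+ k ℕ.* k ℕ.* T →
      N₀ ℕ.* (n ℕ.* A ℕ.^ j) ℕ.+ N ℕ.* (n ℕ.* A ℕ.^ j) ℕ.≤ N ℕ.* T ℕ.^ j ℕ.+ N ℕ.* (n ℕ.* (T ℕ.* A ℕ.^ i)) →
      (1ℚ + K) * ι N₀ ≤ (1ℚ + (1ℚ + K) * (ι 2 * d)) * ι N
    second-moment-bound i {N₀} {A} {T} {K} {d} 0≤K small-q z≤½ z≤d A≤T mT≤ moment≤ =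
      cancel-≤ n (0<ι (suc j))
        (≤-from-gap (0≤1+K ⊗ gap divided ⊕ 0≤ι N ⊗ gap tail ⊕ 0≤1+K ⊗ gap r-1≤2d ⊗ (0≤ι N ⊗ 0≤ι (suc j)))
          (solve 7 (λ k d n N N₀ r w →
             (con 1ℚ :+ (con 1ℚ :+ k) :* (con (ι 2) :* d)) :* N :* n :=
             (con 1ℚ :+ k) :* N₀ :* n :+ ((con 1ℚ :+ k) :* (N :* w :+ N :* (n :* r) :- (N₀ :* n :+ N :* n)) :+
               N :* (n :- (con 1ℚ :+ k) :* w) :+ (con 1ℚ :+ k) :* (con (ι 2) :* d :- (r :- con 1ℚ)) :* (N :* n)))
             refl K d n (ι N) (ι N₀) r (r ^ j)))
      where
      open ℚ.≤-Reasoning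
      j = suc i
      N = T ℕ.^ suc j
      n = ι (suc j)
      z = ι k * x
      a = ι A ^ j
      r = + T / A
      0≤1+K : 0ℚ ≤ 1ℚ + K
      0≤1+K = ℚ.<⇒≤ (0<ι 1) ⊕ 0≤K
      0≤z : 0ℚ ≤ z
      0≤z = 0≤ι k ⊗ 0≤k/m
      rA : r * ι A ≡ ι T
      rA = /-*-cancel T A
      1≤r : 1ℚ ≤ r
      1≤r = cancel-≤ (ι A) (0<ι A) (subst₂ _≤_ (sym (ℚ.*-identityˡ (ι A))) (sym rA) (ι-mono A≤T))
      -- The inequality mT ≤ mα + k²T divided by mα.
      r≤1+zr : r ≤ 1ℚ + z * r
      r≤1+zr = cancel-≤ (ι m * ι A) 0<mA (begin
        r * (ι m * ι A)                    ≡⟨ solve 3 (λ r m a → r :* (m :* a) := m :* (r :* a)) refl r (ι m) (ι A) ⟩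
        ι m * (r * ι A)                    ≡⟨ trans (cong (ι m *_) rA) (sym (ι-* m T)) ⟩
        ι (m ℕ.* T)                        ≤⟨ ι-≤-+ {b = m ℕ.* A} mT≤ ⟩
        ι (m ℕ.* A) + ι (k ℕ.* k ℕ.* T)    ≡⟨ cong₂ _+_ (ι-* m A) (trans (ι-* (k ℕ.* k) T) (cong₂ _*_ (ι-* k k) (sym rA))) ⟩
        ι m * ι A + ι k * ι k * (r * ι A)  ≡⟨ cong (λ t → ι m * ι A + ι k * t * (r * ι A)) (sym xm) ⟩
        ι m * ι A + ι k * (x * ι m) * (r * ι A) ≡⟨ solve 5 (λ m a k x r → m :* a :+ k :* (x :* m) :* (r :* a) := (con 1ℚ :+ k :* x :* r) :* (m :* a)) refl (ι m) (ι A) (ι k) x r ⟩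
        (1ℚ + z * r) * (ι m * ι A)         ∎)
        where
        0<mA : 0ℚ < ι m * ι A
        0<mA = subst (0ℚ <_) (ι-* m A) (0<ι (m ℕ.* A) {{ℕ.m*n≢0 m A}})
      r-1≤ : r - 1ℚ ≤ z + ι 2 * (z * z)
      r-1≤ = ratio-bound 0≤z z≤½ r≤1+zr
      -- As z ≤ 1/2, z + 2z² ≤ 2z ≤ 2d.
      r-1≤2d : r - 1ℚ ≤ ι 2 * d
      r-1≤2d = ℚ.≤-trans r-1≤ (≤-from-gap (0≤ι 2 ⊗ gap z≤d ⊕ 0≤z ⊗ (gap z≤½ ⊕ gap z≤½))
        (solve 2 (λ z d → con (ι 2) :* d := z :+ con (ι 2) :* (z :* z) :+ (con (ι 2) :* (d :- z) :+ z :* (con ℚ.½ :- z :+ (con ℚ.½ :- z)))) refl z d))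
      nz≤ : n * z + (K + ι 6) ≤ H j
      nz≤ = subst (λ q → q + (K + ι 6) ≤ H j) (k²n/m≡n*[k*[k/m]] (suc j)) small-q
      tail : (1ℚ + K) * r ^ j ≤ n
      tail = lower-tail j 1≤r 0≤K (deficit j {r} 0≤z 0≤K r-1≤ (nz²≤3 j 0≤z (ℚ.≤-trans (≤-from-gap (0≤K ⊕ 0≤ι 6) refl) nz≤)) nz≤)
      ι-T^j : ι (T ℕ.^ j) ≡ r ^ j * a
      ι-T^j = trans (ι-^ T j) (trans (cong (_^ j) (sym rA)) (Exp.^-distrib-* r (ι A) j))
      ι-TA^i : ι (T ℕ.* A ℕ.^ i) ≡ r * a
      ι-TA^i = trans (ι-* T (A ℕ.^ i)) (trans (cong₂ _*_ (sym rA) (ι-^ A i)) (ℚ.*-assoc r (ι A) (ι A ^ i)))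
      ι-nA^j : ι (suc j ℕ.* A ℕ.^ j) ≡ n * a
      ι-nA^j = trans (ι-* (suc j) (A ℕ.^ j)) (cong (n *_) (ι-^ A j))
      -- The counting inequality divided by αʲ, so that T and α survive only through r.
      divided : ι N₀ * n + ι N * n ≤ ι N * r ^ j + ι N * (n * r)
      divided = cancel-≤ a (subst (0ℚ <_) (ι-^ A j) (0<ι (A ℕ.^ j) {{ℕ.m^n≢0 A j}})) (begin
        (ι N₀ * n + ι N * n) * a           ≡⟨ solve 4 (λ p q n a → (p :* n :+ q :* n) :* a := p :* (n :* a) :+ q :* (n :* a)) refl (ι N₀) (ι N) n a ⟩
        ι N₀ * (n * a) + ι N * (n * a)     ≡⟨ cong (λ t → ι N₀ * t + ι N * t) (sym ι-nA^j) ⟩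
        ι N₀ * ι nA + ι N * ι nA           ≡⟨ cong₂ _+_ (sym (ι-* N₀ nA)) (sym (ι-* N nA)) ⟩
        ι (N₀ ℕ.* nA) + ι (N ℕ.* nA)       ≡⟨ sym (ι-+ (N₀ ℕ.* nA) (N ℕ.* nA)) ⟩
        ι (N₀ ℕ.* nA ℕ.+ N ℕ.* nA)         ≤⟨ ι-≤-+ {b = N ℕ.* T ℕ.^ j} moment≤ ⟩
        ι (N ℕ.* T ℕ.^ j) + ι (N ℕ.* (suc j ℕ.* (T ℕ.* A ℕ.^ i)))
          ≡⟨ cong₂ _+_ (trans (ι-* N (T ℕ.^ j)) (cong (ι N *_) ι-T^j))
               (trans (ι-* N (suc j ℕ.* (T ℕ.* A ℕ.^ i))) (cong (ι N *_) (trans (ι-* (suc j) (T ℕ.* A ℕ.^ i)) (cong (n *_) ι-TA^i)))) ⟩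
        ι N * (r ^ j * a) + ι N * (n * (r * a)) ≡⟨ solve 5 (λ q w n r a → q :* (w :* a) :+ q :* (n :* (r :* a)) := (q :* w :+ q :* (n :* r)) :* a) refl (ι N) (r ^ j) n r a ⟩
        (ι N * r ^ j + ι N * (n * r)) * a  ∎)
        where nA = suc j ℕ.* A ℕ.^ j

-- The two halves of the threshold

module _ where
  open import Data.Integer.Base using (+_)
  open import Data.Rational.Base using (_/_; _+_; _-_; -_; _*_; _≤_; _<_)

  -- The complementary event has probability N₀/N ≤ c/(1 + K) < ε; all quotients except the
  -- probability itself are multiplied out.
  Pr-near-1 : ∀ a N₀ N K c {ε} .{{_ : NonZero N}} → a ℕ.+ N₀ ≡ N → 0ℚ ≤ K →
    (1ℚ + K) * ι N₀ ≤ c * ι N → c < (1ℚ + K) * ε → ℚ.∣ + a / N - 1ℚ ∣ < ε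
  Pr-near-1 a N₀ N K c {ε} eq 0≤K bound c< = subst (_< ε) (sym (∣a/N-1∣≡1-a/N a N₀ N eq)) (ℚ.≰⇒> λ ε≤p →
    ℚ.<-irrefl refl (ℚ.<-≤-trans c< (ℚ.≤-trans
      (ℚ.*-monoˡ-≤-nonNeg (1ℚ + K) {{ℚ.nonNegative (ℚ.<⇒≤ (0<ι 1) ⊕ 0≤K)}} ε≤p)
      (cancel-≤ (ι N) (0<ι N) (subst (_≤ c * ι N)
        (trans (cong ((1ℚ + K) *_) (sym ([1-a/N]*N a N₀ N eq))) (sym (ℚ.*-assoc (1ℚ + K) (1ℚ - + a / N) (ι N)))) bound)))))

  eventually-3≤nd² : ∀ {d} → 0ℚ < d → ∃ λ M → ∀ n → M ℕ.≤ n → ι 3 ≤ ι n * (d * d)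
  eventually-3≤nd² {d} 0<d = M , λ n M≤n →
    ≤-from-gap (gap (ℚ.≤-trans 3f²≤M (ι-mono M≤n)) ⊗ (ℚ.<⇒≤ 0<d ⊗ ℚ.<⇒≤ 0<d))
      (trans (solve 3 (λ n d f → n :* (d :* d) := con (ι 3) :* (f :* d :* (f :* d)) :+ (n :- con (ι 3) :* (f :* f)) :* (d :* d)) refl (ι n) d f)
        (cong (λ t → ι 3 * (t * t) + (ι n - ι 3 * (f * f)) * (d * d)) fd≡1))
    where
    open ℚ-Solver
    f = proj₁ (inverse 0<d)
    fd≡1 : f * d ≡ 1ℚ
    fd≡1 = proj₂ (proj₂ (inverse 0<d))
    M = proj₁ (archimedean (ι 3 * (f * f)))
    3f²≤M : ι 3 * (f * f) ≤ ι M
    3f²≤M = proj₂ (archimedean (ι 3 * (f * f)))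

  module _ (k m : ℕ → ℕ) (k>0 : ∀ n → NonZero (k n)) (m>0 : ∀ n → NonZero (m n)) (k≤m : ∀ n → k n ℕ.≤ m n)
           (ω : ℕ → ℝ) (ω→∞ : ω ⟶∞) where
    open ℚ-Solver

    k²n/m : ℕ → ℚ
    k²n/m n = (+ (k n ℕ.^ 2 ℕ.* n) / m n) {{m>0 n}}

    above-threshold : (∀ n .{{_ : NonZero n}} → fromℚ (k²n/m n) ≃ log n +ᴿ ω n) →
      AsymptoticallyAlmostSurely m k k≤m NoIsolatedVertex noIsolatedVertex?
    -- The 2 ensures that j = n - 1 is nonzero, as `excess` requires.
    above-threshold q≃ ε 0<ε = 2 ℕ.+ N₁ , close
      where
      e = proj₁ (inverse 0<ε)
      eε≡1 : e * ε ≡ 1ℚ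
      eε≡1 = proj₂ (proj₂ (inverse 0<ε))
      -- With K = 3/ε, (1 + K)ε = ε + 3 exceeds the constant 3 of the first-moment bound.
      K = ι 3 * e
      0≤K : 0ℚ ≤ K
      0≤K = 0≤ι 3 ⊗ proj₁ (proj₂ (inverse 0<ε))
      -- The surplus 2K + 2 is for `excess`, the 3 for the tolerances of the real numbers.
      N₁ = proj₁ (ω→∞ (ι 2 * K + ι 2 + ι 3))
      ω-large = proj₂ (ω→∞ (ι 2 * K + ι 2 + ι 3))
      close : ∀ n → 2 ℕ.+ N₁ ℕ.≤ n → ℚ.∣ PrG n (m n) (k n) (k≤m n) NoIsolatedVertex noIsolatedVertex? - 1ℚ ∣ < ε
      close (suc zero) (ℕ.s≤s ())
      close n@(suc j@(suc i)) N≤n = Pr-near-1 (length (filter noIso? Ω)) (length (filter hasIso? Ω)) (length Ω) K (ι 3) {{assignments-nonZero n (k≤m n)}}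
        (length-filter-¬ hasIso? Ω) 0≤K
        (subst (λ N → (1ℚ + K) * ι (length (filter hasIso? Ω)) ≤ ι 3 * ι N) (sym (length-assignments n (m n) (k n)))
          (first-moment-bound (m n) (k n) (k≤m n) j {N₀ = length (filter hasIso? Ω)} {A = (m n ℕ.∸ k n) C k n} {T = m n C k n} 0≤K
            (≃-log+ω j {k²n/m n} {ι 2 * K + ι 2} {ω n} (ω-large n (ℕ.≤-trans (ℕ.m≤n+m N₁ 2) N≤n)) (q≃ n))
            (C-ratio {m n ℕ.∸ k n} {m n} (k n) (ℕ.m∸n≤m (m n) (k n)))
            (#hasIsolated≤ (m n) (k n) j)))
        (subst (ι 3 <_) (trans (cong (λ t → ε + ι 3 * t) (sym eε≡1)) (solve 2 (λ ε e → ε :+ con (ι 3) :* (e :* ε) := (con 1ℚ :+ con (ι 3) :* e) :* ε) refl ε e))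
          (ℚ.+-monoˡ-< (ι 3) 0<ε))
        where
        instance
          _ = m>0 n
        Ω = assignments n (m n) (k n)
        hasIso? = hasIsolated? {n} {m n}
        noIso? = λ F → noIsolatedVertex? (intersectionGraph {n} {m n} F)

    below-threshold : (∀ n .{{_ : NonZero n}} → fromℚ (k²n/m n) ≃ log n -ᴿ ω n) →
      AsymptoticallyAlmostSurely m k k≤m HasIsolatedVertex hasIsolatedVertex?
    -- From N₁ on ω is large enough, from M₁ on k²/m ≤ d, from M₂ on k²/m ≤ 1/2. The 2 provides a
    -- pair of distinct vertices.
    below-threshold q≃ ε 0<ε = 2 ℕ.+ (N₁ ℕ.+ M₁ ℕ.+ M₂) , close
      where
      e = proj₁ (inverse 0<ε)
      eε≡1 : e * ε ≡ 1ℚ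
      eε≡1 = proj₂ (proj₂ (inverse 0<ε))
      -- With K = 2/ε and d = ε/4, (1 + K)(ε - 2d) = ε/2 + 1 > 1, which is the strict inequality
      -- needed at the end.
      K = ι 2 * e
      0≤K : 0ℚ ≤ K
      0≤K = 0≤ι 2 ⊗ proj₁ (proj₂ (inverse 0<ε))
      d = ℚ.½ * (ℚ.½ * ε)
      0<½ε : 0ℚ < ℚ.½ * ε
      0<½ε = ℚ.*-monoʳ-<-pos ℚ.½ 0<ε
      0<d : 0ℚ < d
      0<d = ℚ.*-monoʳ-<-pos ℚ.½ 0<½ε
      -- The 6 is for the second-order term in `deficit`, the 3 for the tolerances of the real
      -- numbers.
      N₁ = proj₁ (ω→∞ (K + ι 6 + ι 3))
      ω-large = proj₂ (ω→∞ (K + ι 6 + ι 3))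
      M₁ = proj₁ (eventually-3≤nd² 0<d)
      M₂ = proj₁ (eventually-3≤nd² (ℚ.positive⁻¹ ℚ.½))
      close : ∀ n → 2 ℕ.+ (N₁ ℕ.+ M₁ ℕ.+ M₂) ℕ.≤ n → ℚ.∣ PrG n (m n) (k n) (k≤m n) HasIsolatedVertex hasIsolatedVertex? - 1ℚ ∣ < ε
      close (suc zero) (ℕ.s≤s ())
      close n@(suc j@(suc i)) N≤n = Pr-near-1 (length (filter hasIso? Ω)) (length (filter noIso? Ω)) (length Ω) K (1ℚ + (1ℚ + K) * (ι 2 * d)) {{assignments-nonZero n (k≤m n)}}
        (trans (ℕ.+-comm (length (filter hasIso? Ω)) (length (filter noIso? Ω))) (length-filter-¬ hasIso? Ω)) 0≤K
        (subst (λ N → (1ℚ + K) * ι (length (filter noIso? Ω)) ≤ (1ℚ + (1ℚ + K) * (ι 2 * d)) * ι N) (sym (length-assignments n (m n) (k n)))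
          (second-moment-bound (m n) (k n) (k≤m n) i {N₀ = length (filter noIso? Ω)} {A = (m n ℕ.∸ k n) C k n} {T = m n C k n} 0≤K q≤ z≤½ z≤d
            (subst (λ t → (m n ℕ.∸ k n) C k n ℕ.≤ t C k n) (ℕ.m∸n+n≡m (k≤m n)) (C-mono (m n ℕ.∸ k n) (k n) (k n)))
            (C-disjoint-bound {m n} (k n) (k≤m n))
            (#noIsolated≤ (m n) (k n) i 2k≤m)))
        (subst₂ _<_ (ℚ.+-identityˡ (1ℚ + (1ℚ + K) * (ι 2 * d))) eq (ℚ.+-monoˡ-< (1ℚ + (1ℚ + K) * (ι 2 * d)) 0<½ε))
        where
        Ω = assignments n (m n) (k n)
        hasIso? = hasIsolated? {n} {m n}
        noIso? = λ F → noIsolatedVertex? (intersectionGraph {n} {m n} F)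
        N′≤n : N₁ ℕ.+ M₁ ℕ.+ M₂ ℕ.≤ n
        N′≤n = ℕ.≤-trans (ℕ.m≤n+m (N₁ ℕ.+ M₁ ℕ.+ M₂) 2) N≤n
        N₁+M₁≤n : N₁ ℕ.+ M₁ ℕ.≤ n
        N₁+M₁≤n = ℕ.m+n≤o⇒m≤o (N₁ ℕ.+ M₁) N′≤n
        instance
          _ = m>0 n
          _ = k>0 n
        q≤ : k²n/m n + (K + ι 6) ≤ H j
        q≤ = ≃-log-ω j {k²n/m n} {K + ι 6} {ω n} (ω-large n (ℕ.m+n≤o⇒m≤o N₁ N₁+M₁≤n)) (q≃ n)
        0≤K+6 : 0ℚ ≤ K + ι 6
        0≤K+6 = 0≤K ⊕ 0≤ι 6
        z≤½ : ι (k n) * (+ k n / m n) ≤ ℚ.½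
        z≤½ = k²/m≤ (m n) (k n) (k≤m n) j 0≤K+6 q≤ (ℚ.positive⁻¹ ℚ.½) (proj₂ (eventually-3≤nd² (ℚ.positive⁻¹ ℚ.½)) n (ℕ.m+n≤o⇒n≤o (N₁ ℕ.+ M₁) N′≤n))
        z≤d : ι (k n) * (+ k n / m n) ≤ d
        z≤d = k²/m≤ (m n) (k n) (k≤m n) j 0≤K+6 q≤ 0<d (proj₂ (eventually-3≤nd² 0<d) n (ℕ.m+n≤o⇒n≤o N₁ N₁+M₁≤n))
        2k≤m : k n ℕ.+ k n ℕ.≤ m n
        -- From k²/m ≤ 1/2 and k ≥ 1: 2k ≤ 2k² ≤ m. Then k ≤ m - k, so α is nonzero.
        2k≤m = ℕ.≤-trans
          (subst (ℕ._≤ 2 ℕ.* (k n ℕ.* k n)) (cong (k n ℕ.+_) (ℕ.+-identityʳ (k n))) (ℕ.*-monoʳ-≤ 2 (ℕ.m≤m*n (k n) (k n))))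
          (2k²≤m (m n) (k n) (k≤m n) z≤½)
        instance
          _ = C-pos {m n} {k n} (k≤m n)
          _ = C-pos {m n ℕ.∸ k n} {k n} (subst (ℕ._≤ m n ℕ.∸ k n) (ℕ.m+n∸n≡m (k n) (k n)) (ℕ.∸-monoˡ-≤ (k n) 2k≤m))
        eq : ℚ.½ * ε + (1ℚ + (1ℚ + K) * (ι 2 * d)) ≡ (1ℚ + K) * ε
        eq = trans (cong (λ t → ℚ.½ * ε + (t + (1ℚ + K) * (ι 2 * d))) (sym eε≡1))
          (solve 2 (λ ε e → con ℚ.½ :* ε :+ (e :* ε :+ (con 1ℚ :+ con (ι 2) :* e) :* (con (ι 2) :* (con ℚ.½ :* (con ℚ.½ :* ε)))) := (con 1ℚ :+ con (ι 2) :* e) :* ε) refl ε e)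

open import Data.Nat using (ℕ; NonZero; _≤_; _^_; _*_)
open import Data.Integer using (+_)
open import Data.Rational using (_/_)
open import Data.Product using (_×_)

theorem2 : (k m : ℕ → ℕ) →
    (k>0 : ∀ n → NonZero (k n)) → (m>0 : ∀ n → NonZero (m n)) →
    (k≤m : ∀ n → k n ≤ m n) →
    ((ω : ℕ → ℝ) → ω ⟶∞ →
    (∀ n .{{_ : NonZero n}} → fromℚ ((+ (k n ^ 2 * n) / m n) {{m>0 n}}) ≃ log n +ᴿ ω n) →
    AsymptoticallyAlmostSurely m k k≤m NoIsolatedVertex noIsolatedVertex?)
    ×
    ((ω : ℕ → ℝ) → ω ⟶∞ →
    (∀ n .{{_ : NonZero n}} → fromℚ ((+ (k n ^ 2 * n) / m n) {{m>0 n}}) ≃ log n -ᴿ ω n) →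
    AsymptoticallyAlmostSurely m k k≤m HasIsolatedVertex hasIsolatedVertex?)
theorem2 k m k>0 m>0 k≤m =
  above-threshold k m k>0 m>0 k≤m , below-threshold k m k>0 m>0 k≤m
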